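{- Let $(\mathbb{T},\log,\partial,\circ,x)$, with $\mathbb{T}=\mathbf{R}[[\mathfrak{N}]]$, be a structure satisfying conditions (i)–(viii) of the context, and assume that any two $f,g\in\mathbb{T}^{>\mathbf{R}}$ with $f,g>x$ are conjugate in the group $(\mathbb{T}^{>\mathbf{R}},\circ,x)$. For $f\in\mathbb{T}^{>\mathbf{R}}$ let $\mathcal{C}(f)=\{h\in\mathbb{T}^{>\mathbf{R}}:h\circ f=f\circ h\}$. Then for all $f,g\in\mathbb{T}^{>\mathbf{R}}$ with $f,g>x$: (1) if $f>h$ for all $h\in\mathcal{C}(g)$, then $f\circ g>g\circ f$; (2) if $f\geqslant g$, then for every $g_0\in\mathcal{C}(g)$ there is an $f_0\in\mathcal{C}(f)$ with $f_0\geqslant g_0$.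
   Context: Well-based series. The set theory is NBG; groups and fields may be proper classes. For an ordered field $\mathbf{R}$ and a linearly ordered abelian group $(\mathfrak{N},\cdot,1,\prec)$, $\mathbf{R}[[\mathfrak{N}]]$ is the ordered field of functions $s:\mathfrak{N}\to\mathbf{R}$ whose support $\operatorname{supp}s$ is a set well-ordered for $\succ$, with pointwise sum and Cauchy product; $s>0$ iff $s\neq0$ and $s(\max\operatorname{supp}s)>0$. Monomials (elements of $\mathfrak{N}$) and elements of $\mathbf{R}$ are identified with series. For $s\neq0$, $\mathfrak{d}(s)=\max\operatorname{supp}s$. $s\prec t$ means $r|s|<|t|$ for all $r\in\mathbf{R}^{>}$; $s\preccurlyeq t$ means not $t\prec s$. $\mathbb{T}_{\succ}=\{s:\operatorname{supp}s\succ1\}$ and $\mathbb{T}^{>\mathbf{R}}=\mathbb{T}^{>,\succ}=\{s:s>\mathbf{R}\}$. A family $(s_i)$ is summable if $\bigcup_i\operatorname{supp}s_i$ is a set well-ordered by $\succ$ and each monomial lies in finitely many $\operatorname{supp}s_i$; an $\mathbf{R}$-linear map is strongly linear if it preserves summability and commutes with sums of summable families. When $\log$ is given, for $s,t\in\mathbb{T}^\times$: $s\prec\!\!\prec t$ iff $\log|s|\prec\log|t|$; $s\preccurlyeq\!\!\preccurlyeq t$ iff $\log|s|\preccurlyeq\log|t|$. Write $f'=\partial(f)$, $f^{(k)}=\partial^k(f)$. Conditions. (i) $\mathfrak{N}$ is a linearly ordered abelian group, $\mathbf{R}$ an ordered field, $\mathbb{T}=\mathbf{R}[[\mathfrak{N}]]$.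 (ii) $(\mathbb{T},\log)$ is an exponentially closed transserial field: $\log:(\mathbb{T}^{>},\cdot,1,<)\to(\mathbb{T},+,0,<)$ is an isomorphism of ordered groups, $\log\mathfrak{N}\subseteq\mathbb{T}_{\succ}$, $\log s\leqslant s-1$ for $s\in\mathbb{T}^{>}$, $\log(1+\varepsilon)=\sum_{k>0}\frac{(-1)^{k+1}}{k}\varepsilon^k$ for $\varepsilon\prec1$, and $\log$ restricts to an isomorphism $(\mathbf{R}^{>},\cdot,<)\to(\mathbf{R},+,<)$. (iii) $\partial:\mathbb{T}\to\mathbb{T}$ is a surjective transserial derivation (strongly linear, Leibniz rule, $\partial(\log|s|)=\partial(s)/s$ for $s\neq0$), with identity $x\in\mathfrak{N}$ ($x>0$, $x \neq 1$, $\partial(x)=1$), which is flat: for $\mathfrak{m}\in\mathfrak{N}$ and $\mathfrak{n}\in\operatorname{supp}\partial(\mathfrak{m})$ there are $\mathfrak{f},\mathfrak{w}\in\mathfrak{N}$ with $\mathfrak{f}\prec\!\!\prec\mathfrak{m}$, $\mathfrak{w}\preccurlyeq\!\!\preccurlyeq x$, $\mathfrak{n}=\mathfrak{m}\mathfrak{f}\mathfrak{w}$. (iv) $(\mathbb{T},\partial)$ is an H-field: $\ker\partial=\mathbf{R}$ and $f'>0$ for $f\in\mathbb{T}^{>,\succ}$. (v) $\circ:\mathbb{T}\times\mathbb{T}^{>,\succ}\to\mathbb{T}$ is a transserial composition law (each $f\mapsto f\circ s$ is a strongly linear morphism of ordered rings commuting with $\log$, and $f\circ(s\circ t)=(f\circ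 s)\circ t$) with identity $x$ ($x\circ s=s$, $f\circ x=f$), which is flat: for $s\in\mathbb{T}^{>,\succ}$, $\mathfrak{m}\in\mathfrak{N}\setminus\{1\}$, $\mathfrak{n}\in\operatorname{supp}(\mathfrak{m}\circ s)$ there are $\mathfrak{f},\mathfrak{w}\in\mathfrak{N}$, $\mathfrak{u}\in\operatorname{supp}s$ with $\mathfrak{f}\prec\!\!\prec\mathfrak{m}$, $\mathfrak{w}\preccurlyeq1$, $\mathfrak{w}\preccurlyeq\!\!\preccurlyeq\mathfrak{u}$, $\mathfrak{n}=\mathfrak{d}(\mathfrak{m}\circ s)\mathfrak{f}\mathfrak{w}$. (vi) Chain rule $(f\circ s)'=s'(f'\circ s)$; and Taylor expansions: whenever $s\in\mathbb{T}^{>,\succ}$, $\delta\prec s$, and $(\mathfrak{m}'\circ s)\delta\prec\mathfrak{m}\circ s$ for all $\mathfrak{m}\in\operatorname{supp}f$, the family $((\mathfrak{m}^{(k)}\circ s)\delta^k)_{\mathfrak{m}\in\operatorname{supp}f,k\in\mathbb{N}}$ is summable, $f\circ(s+\delta)=\sum_k\frac{f^{(k)}\circ s}{k!}\delta^k=\sum_{\mathfrak{m},k}f(\mathfrak{m})\frac{\mathfrak{m}^{(k)}\circ s}{k!}\delta^k$, and $(f^{(k)}\circ s)\delta^k\succ(f^{(k+1)}\circ s)\delta^{k+1}$ whenever the left side is nonzero. (vii) $(\mathbb{T}^{>,\succ},\circ,x)$ is a group. (viii) Monotonicity: for $f\in\mathbb{T}\setminus\mathbf{R}$, the map $s\mapsto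 f\circ s$ on $\mathbb{T}^{>,\succ}$ is strictly increasing if $f'>0$ and strictly decreasing if $f'<0$. Under these conditions $(\mathbb{T}^{>\mathbf{R}},\circ,x,<)$ is a linearly bi-ordered group. Elements $f,g$ are conjugate if $h\circ f=g\circ h$ for some $h\in\mathbb{T}^{>\mathbf{R}}$. -}

module Defs where

open import Algebra.Bundles
  using (AbelianGroup; CommutativeRing; RawMonoid; RawRing)
open import Algebra.Module.Bundles.Raw using (RawLeftModule)
open import Algebra.Module.Morphism.Structures using (module LeftModuleMorphisms)
open import Algebra.Morphism.Structures
  using (module MonoidMorphisms; module RingMorphisms)
open import Algebra.Structures using (IsGroup)
import Algebra.Definitions.RawMonoid as RawMonoidDefs
import Algebra.Definitions.RawSemiring as RawSemiringDefs
import Algebra.Properties.CommutativeSemigroup as CommutativeSemigroupProperties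
import Algebra.Properties.Ring as RingProperties
open import Axiom.ExcludedMiddle using (ExcludedMiddle)
open import Data.Empty using (⊥-elim)
open import Data.List.Base using (List; []; _∷_; foldr)
open import Data.List.Relation.Unary.All as All using (All; []; _∷_)
open import Data.List.Relation.Unary.AllPairs using ([]; _∷_)
open import Data.List.Relation.Unary.Any using (here; there)
import Data.List.Membership.Setoid as SetoidMembership
import Data.List.Relation.Unary.Unique.Setoid as SetoidUnique
open import Data.Nat.Base as ℕ using (ℕ; zero; suc; _!)
open import Data.Nat.GeneralisedArithmetic using (fold)
open import Data.Nat.Properties using (_!≢0)
open import Data.Product.Base using (Σ; ∃; _×_; _,_; proj₁; proj₂)
open import Data.Product.Relation.Binary.Pointwise.NonDependent using (×-setoid)
open import Data.Sum.Base using (_⊎_; inj₁; inj₂; [_,_]′)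
open import Data.Unit.Base using (⊤; tt)
open import Function.Base using (_on_; _∘′_)
open import Function.Bundles using (Func; _⟨$⟩_)
open import Function.Definitions using (Surjective)
open import Induction.WellFounded using (WellFounded; Acc; acc; module Subrelation)
open import Level using (Level; _⊔_; Lift; lift) renaming (suc to lsuc)
open import Relation.Binary.Bundles using (Setoid)
open import Relation.Binary.Core using (Rel)
open import Relation.Binary.Definitions using (tri<; tri≈; tri>)
open import Relation.Binary.Structures using (IsStrictTotalOrder)
open import Relation.Binary.Morphism.Structures
  using (IsOrderHomomorphism; IsOrderIsomorphism)
import Relation.Binary.Construct.On as On
open import Relation.Binary.PropositionalEquality as ≡ using (_≡_)
import Relation.Binary.Reasoning.Setoid as SetoidReasoning
open import Relation.Nullary using (¬_; Dec; yes; no)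
open import Relation.Unary using (Pred; _⊆_; _∪_)

private
  variable
    a b i j p q : Level

record OrderedField (κ : Level) : Set (lsuc κ) where
  infix 4 _<_
  field
    commutativeRing : CommutativeRing κ κ
  open CommutativeRing commutativeRing public
  field
    _<_                : Rel Carrier κ
    isStrictTotalOrder : IsStrictTotalOrder _≈_ _<_
    +-monoˡ-<          : ∀ z {x y} → x < y → x + z < y + z
    *-pos              : ∀ {x y} → 0# < x → 0# < y → 0# < x * y
    0<1                : 0# < 1#
    inverse            : ∀ x → ¬ x ≈ 0# → ∃ λ y → x * y ≈ 1#

  module Order = IsStrictTotalOrder isStrictTotalOrder
  open RingProperties ring public using (-0#≈0#; -‿involutive; -‿distribʳ-*)

  +-pos : ∀ {x y} → 0# < x → 0# < y → 0# < x + y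
  +-pos {x} {y} 0<x 0<y =
    Order.trans 0<y (Order.<-respˡ-≈ (+-identityˡ y) (+-monoˡ-< y 0<x))

  pos⇒≉0 : ∀ {x} → 0# < x → ¬ x ≈ 0#
  pos⇒≉0 0<x x≈0 = Order.irrefl (sym x≈0) 0<x

  neg⇒-pos : ∀ {x} → x < 0# → 0# < - x
  neg⇒-pos {x} x<0 = Order.<-respˡ-≈ (-‿inverseʳ x)
    (Order.<-respʳ-≈ (+-identityˡ (- x)) (+-monoˡ-< (- x) x<0))

  open RawMonoidDefs +-rawMonoid using () renaming (_×_ to _ℕ×_) public

  ℕ×1-pos : ∀ n → 0# < suc n ℕ× 1#
  ℕ×1-pos zero    = Order.<-respʳ-≈ (sym (+-identityʳ 1#)) 0<1
  ℕ×1-pos (suc n) = +-pos 0<1 (ℕ×1-pos n)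

  1/ : (n : ℕ) .{{_ : ℕ.NonZero n}} → Carrier
  1/ (suc n) = proj₁ (inverse (suc n ℕ× 1#) (pos⇒≉0 (ℕ×1-pos n)))

  open RawSemiringDefs (RawRing.rawSemiring rawRing) using (_^_) public

record LinearlyOrderedAbelianGroup (κ : Level) : Set (lsuc κ) where
  infix 4 _≺_ _≻_ _≼_
  field
    abelianGroup : AbelianGroup κ κ
  open AbelianGroup abelianGroup public
  field
    _≺_                : Rel Carrier κ
    isStrictTotalOrder : IsStrictTotalOrder _≈_ _≺_
    ∙-monoˡ-≺          : ∀ c {a b} → a ≺ b → a ∙ c ≺ b ∙ c

  _≻_ _≼_ : Rel Carrier κ
  a ≻ b = b ≺ a
  a ≼ b = ¬ b ≺ a

  module Order = IsStrictTotalOrder isStrictTotalOrder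

  ≼⇒≺⊎≈ : ∀ {a b} → a ≼ b → a ≺ b ⊎ a ≈ b
  ≼⇒≺⊎≈ {a} {b} a≼b with Order.compare a b
  ... | tri< a≺b _ _ = inj₁ a≺b
  ... | tri≈ _ a≈b _ = inj₂ a≈b
  ... | tri> _ _ b≺a = ⊥-elim (a≼b b≺a)

  ≈⇒≼ : ∀ {a b} → a ≈ b → a ≼ b
  ≈⇒≼ a≈b = Order.irrefl (sym a≈b)

  ≺⇒≼ : ∀ {a b} → a ≺ b → a ≼ b
  ≺⇒≼ = Order.asym

  ≺-≼-trans : ∀ {a b c} → a ≺ b → b ≼ c → a ≺ c
  ≺-≼-trans a≺b b≼c =
    [ Order.trans a≺b , (λ b≈c → Order.<-respʳ-≈ b≈c a≺b) ]′ (≼⇒≺⊎≈ b≼c)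

  ≼-≺-trans : ∀ {a b c} → a ≼ b → b ≺ c → a ≺ c
  ≼-≺-trans a≼b b≺c =
    [ (λ a≺b → Order.trans a≺b b≺c) , (λ a≈b → Order.<-respˡ-≈ (sym a≈b) b≺c) ]′
      (≼⇒≺⊎≈ a≼b)

  ≼-trans : ∀ {a b c} → a ≼ b → b ≼ c → a ≼ c
  ≼-trans a≼b b≼c c≺a = a≼b (≼-≺-trans b≼c c≺a)

  ∙-monoʳ-≺ : ∀ c {a b} → a ≺ b → c ∙ a ≺ c ∙ b
  ∙-monoʳ-≺ c {a} {b} a≺b =
    Order.<-respˡ-≈ (comm a c) (Order.<-respʳ-≈ (comm b c) (∙-monoˡ-≺ c a≺b))

  ∙-mono-≺-≼ : ∀ {a b c d} → a ≺ b → c ≼ d → a ∙ c ≺ b ∙ d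
  ∙-mono-≺-≼ {a} {b} {c} {d} a≺b c≼d with ≼⇒≺⊎≈ c≼d
  ... | inj₁ c≺d = Order.trans (∙-monoˡ-≺ c a≺b) (∙-monoʳ-≺ b c≺d)
  ... | inj₂ c≈d = Order.<-respʳ-≈ (∙-congˡ c≈d) (∙-monoˡ-≺ c a≺b)

  ∙-mono-≼ : ∀ {a b c d} → a ≼ b → c ≼ d → a ∙ c ≼ b ∙ d
  ∙-mono-≼ {a} {b} {c} {d} a≼b c≼d with ≼⇒≺⊎≈ a≼b
  ... | inj₁ a≺b = ≺⇒≼ (∙-mono-≺-≼ a≺b c≼d)
  ... | inj₂ a≈b with ≼⇒≺⊎≈ c≼d
  ...   | inj₁ c≺d = ≺⇒≼ (Order.<-respˡ-≈ (∙-congʳ (sym a≈b)) (∙-monoʳ-≺ b c≺d))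
  ...   | inj₂ c≈d = ≈⇒≼ (∙-cong a≈b c≈d)

  ⁻¹-anti-≺ : ∀ {a b} → a ≺ b → b ⁻¹ ≺ a ⁻¹
  ⁻¹-anti-≺ {a} {b} a≺b with Order.compare (a ⁻¹) (b ⁻¹)
  ... | tri> _ _ lt = lt
  ... | tri≈ _ eq _ = ⊥-elim (Order.irrefl
          (trans (inverseʳ a) (sym (trans (∙-congˡ eq) (inverseʳ b))))
          (∙-monoˡ-≺ (a ⁻¹) a≺b))
  ... | tri< lt _ _ = ⊥-elim (Order.irrefl
          (trans (inverseʳ a) (sym (inverseʳ b)))
          (∙-mono-≺-≼ a≺b (≺⇒≼ lt)))

module FiniteSum {κ : Level} (R : OrderedField κ)
                 {i j : Level} (I : Setoid i j) where
  private
    module R = OrderedField R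
    module I = Setoid I
  open SetoidMembership I using (_∈_)
  open SetoidUnique I using (Unique)

  FinitelySupported : (I.Carrier → R.Carrier) → Set (i ⊔ j ⊔ κ)
  FinitelySupported f =
    ∃ λ L → Unique L × (∀ k → ¬ f k R.≈ R.0# → k ∈ L)

  sumOver : (I.Carrier → R.Carrier) → List I.Carrier → R.Carrier
  sumOver f = foldr (λ k s → f k R.+ s) R.0#

  finSum : (f : I.Carrier → R.Carrier) → FinitelySupported f → R.Carrier
  finSum f (L , _) = sumOver f L

  private
    all≉ : ∀ {k l L} → All (λ m → ¬ k I.≈ m) L → l ∈ L → ¬ k I.≈ l
    all≉ (k≉m ∷ _)  (here l≈m)  k≈l = k≉m (I.trans k≈l l≈m)
    all≉ (_ ∷ rest) (there l∈L) k≈l = all≉ rest l∈L k≈l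

    ≉all : ∀ {k L} → (∀ {l} → l ∈ L → ¬ k I.≈ l) → All (λ m → ¬ k I.≈ m) L
    ≉all {L = []}    h = []
    ≉all {L = m ∷ L} h = h (here I.refl) ∷ ≉all (λ l∈L → h (there l∈L))

    record Extraction (f : I.Carrier → R.Carrier) (k : I.Carrier)
                      (L : List I.Carrier) : Set (i ⊔ j ⊔ κ) where
      field
        rest   : List I.Carrier
        unique : Unique rest
        sum≈   : sumOver f L R.≈ f k R.+ sumOver f rest
        back   : ∀ {l} → l ∈ L → l I.≈ k ⊎ l ∈ rest
        forth  : ∀ {l} → l ∈ rest → l ∈ L × ¬ k I.≈ l

    module _ {f : I.Carrier → R.Carrier}
             (f-cong : ∀ {k l} → k I.≈ l → f k R.≈ f l) where

      extract : ∀ {k L} → Unique L → k ∈ L → Extraction f k L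
      extract {k} {m ∷ L} (m≉L ∷ uL) (here k≈m) = record
        { rest   = L
        ; unique = uL
        ; sum≈   = R.+-congʳ (f-cong (I.sym k≈m))
        ; back   = λ { (here l≈m)  → inj₁ (I.trans l≈m (I.sym k≈m))
                     ; (there l∈L) → inj₂ l∈L }
        ; forth  = λ l∈L → there l∈L , λ k≈l → all≉ m≉L l∈L (I.trans (I.sym k≈m) k≈l)
        }
      extract {k} {m ∷ L} (m≉L ∷ uL) (there k∈L) = record
        { rest   = m ∷ E.rest
        ; unique = ≉all (λ l∈r → all≉ m≉L (proj₁ (E.forth l∈r))) ∷ E.unique
        ; sum≈   = R.trans (R.+-congˡ E.sum≈)
                     (R.trans (R.sym (R.+-assoc _ _ _))
                       (R.trans (R.+-congʳ (R.+-comm _ _)) (R.+-assoc _ _ _)))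
        ; back   = λ { (here l≈m)  → inj₂ (here l≈m)
                     ; (there l∈L) → [ inj₁ , inj₂ ∘′ there ]′ (E.back l∈L) }
        ; forth  = λ { (here l≈m)  → here l≈m ,
                         λ k≈l → all≉ m≉L k∈L (I.sym (I.trans k≈l l≈m))
                     ; (there l∈r) → there (proj₁ (E.forth l∈r)) , proj₂ (E.forth l∈r) }
        }
        where module E = Extraction (extract uL k∈L)

  module _ (zero? : ∀ r → Dec (r R.≈ R.0#))
           {f g : I.Carrier → R.Carrier}
           (g-cong : ∀ {k l} → k I.≈ l → g k R.≈ g l)
           (f≈g : ∀ k → f k R.≈ g k) where

    private
      sumOver-zero : ∀ L → (∀ k → k ∈ L → ¬ ¬ g k R.≈ R.0#) → sumOver g L R.≈ R.0#
      sumOver-zero []      h = R.refl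
      sumOver-zero (k ∷ L) h with zero? (g k)
      ... | yes gk≈0 = R.trans (R.+-cong gk≈0 (sumOver-zero L (λ l l∈L → h l (there l∈L))))
                               (R.+-identityˡ R.0#)
      ... | no  gk≉0 = ⊥-elim (h k (here I.refl) gk≉0)

      sumOver-unique : ∀ L M → Unique L → Unique M →
                       (∀ k → ¬ g k R.≈ R.0# → k ∈ L → k ∈ M) →
                       (∀ k → ¬ g k R.≈ R.0# → k ∈ M → k ∈ L) →
                       sumOver f L R.≈ sumOver g M
      sumOver-unique [] M uL uM L⊆M M⊆L = R.sym (sumOver-zero M
        (λ k k∈M gk≉0 → ∉[] (M⊆L k gk≉0 k∈M)))
        where
        ∉[] : ∀ {k} → ¬ k ∈ []
        ∉[] ()
      sumOver-unique (k ∷ L) M (k≉L ∷ uL) uM L⊆M M⊆L with zero? (g k)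
      ... | yes gk≈0 = R.trans (R.+-cong (R.trans (f≈g k) gk≈0)
              (sumOver-unique L M uL uM
                (λ l gl≉0 l∈L → L⊆M l gl≉0 (there l∈L))
                (λ l gl≉0 l∈M → drop gl≉0 (M⊆L l gl≉0 l∈M))))
              (R.+-identityˡ _)
        where
        drop : ∀ {l} → ¬ g l R.≈ R.0# → l ∈ k ∷ L → l ∈ L
        drop gl≉0 (here l≈k)  = ⊥-elim (gl≉0 (R.trans (g-cong l≈k) gk≈0))
        drop gl≉0 (there l∈L) = l∈L
      ... | no gk≉0 = R.trans (R.+-cong (f≈g k)
              (sumOver-unique L E.rest uL E.unique
                (λ l gl≉0 l∈L → [ (λ l≈k → ⊥-elim (all≉ k≉L l∈L (I.sym l≈k)))
                                , (λ l∈r → l∈r) ]′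
                                (E.back (L⊆M l gl≉0 (there l∈L))))
                (λ l gl≉0 l∈r → drop (proj₂ (E.forth l∈r))
                                     (M⊆L l gl≉0 (proj₁ (E.forth l∈r))))))
              (R.sym E.sum≈)
        where
        module E = Extraction (extract g-cong uM (L⊆M k gk≉0 (here I.refl)))
        drop : ∀ {l} → ¬ k I.≈ l → l ∈ k ∷ L → l ∈ L
        drop k≉l (here l≈k)  = ⊥-elim (k≉l (I.sym l≈k))
        drop k≉l (there l∈L) = l∈L

    -- In particular a finite sum does not depend on the enumeration.
    finSum-cong : (φ : FinitelySupported f) (γ : FinitelySupported g) →
                  finSum f φ R.≈ finSum g γ
    finSum-cong (L , uL , ⊆L) (M , uM , ⊆M) = sumOver-unique L M uL uM
      (λ k gk≉0 _ → ⊆M k gk≉0)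
      (λ k gk≉0 _ → ⊆L k (λ fk≈0 → gk≉0 (R.trans (R.sym (f≈g k)) fk≈0)))

-- em makes the theory classical. R and 𝔑 live in universe κ, whereas sets are
-- the types in universe σ. If σ is below κ, then R and 𝔑 may be proper classes;
-- otherwise every class of monomials is small.

module WellBased (em : {ℓ : Level} → ExcludedMiddle ℓ)
                 {κ : Level} (σ : Level)
                 (R : OrderedField κ) (𝔑 : LinearlyOrderedAbelianGroup κ) where

  module R = OrderedField R
  module 𝔑 = LinearlyOrderedAbelianGroup 𝔑
  open 𝔑 public using (_∙_; ε; _⁻¹)
    renaming (Carrier to Monomial; _≺_ to _≺ᴺ_; _≻_ to _≻ᴺ_; _≼_ to _≼ᴺ_)

  private
    decide : (P : Set p) → Dec P
    decide P = em {P = P}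

    stable : {P : Set p} → ¬ ¬ P → P
    stable {P = P} ¬¬p with decide P
    ... | yes p = p
    ... | no ¬p = ⊥-elim (¬¬p ¬p)

    r≟0 : ∀ r → Dec (r R.≈ R.0#)
    r≟0 r = decide _

  IsSmall : Pred Monomial p → Set (κ ⊔ lsuc σ ⊔ p)
  IsSmall P = Σ (Set σ) λ J → Σ (J → Monomial) λ e → ∀ m → P m → ∃ λ k → m 𝔑.≈ e k

  -- (m , _) precedes (n , _) when m ≻ᴺ n.
  WellOrdered : Pred Monomial p → Set (κ ⊔ p)
  WellOrdered P = WellFounded {A = ∃ P} (_≻ᴺ_ on proj₁)

  IsMaximumOf : Pred Monomial p → Monomial → Set (κ ⊔ p)
  IsMaximumOf P m = P m × (∀ n → P n → n ≼ᴺ m)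

  private
    least : {_⊏_ : Rel Monomial q} {P : Pred Monomial p} →
            WellFounded {A = ∃ P} (_⊏_ on proj₁) →
            ∃ P → ∃ λ m → P m × (∀ n → P n → ¬ n ⊏ m)
    least {_⊏_ = _⊏_} {P} wf x = go x (wf x)
      where
      go : (x : ∃ P) → Acc {A = ∃ P} (_⊏_ on proj₁) x → ∃ λ m → P m × (∀ n → P n → ¬ n ⊏ m)
      go (m , pm) (acc rs) with decide (∃ λ n → P n × n ⊏ m)
      ... | yes (n , pn , n⊏m) = go (n , pn) (rs n⊏m)
      ... | no  none           = m , pm , λ n pn n⊏m → none (n , pn , n⊏m)

    pull : {_⊏_ : Rel Monomial q} {P : Pred Monomial p} {Q : Pred Monomial a} → Q ⊆ P →
           WellFounded {A = ∃ P} (_⊏_ on proj₁) → WellFounded {A = ∃ Q} (_⊏_ on proj₁)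
    pull Q⊆P = On.wellFounded (λ (m , qm) → m , Q⊆P qm)

  abstract
    wellOrdered-⊆ : {P : Pred Monomial p} {Q : Pred Monomial q} →
                    Q ⊆ P → WellOrdered P → WellOrdered Q
    wellOrdered-⊆ = pull

    maximum : {P : Pred Monomial p} → WellOrdered P → ∃ P → ∃ (IsMaximumOf P)
    maximum = least

    wellOrdered : ∀ {p} {P : Pred Monomial p} →
                  ((Q : Pred Monomial (κ ⊔ p)) → Q ⊆ P → ∃ Q → ∃ (IsMaximumOf Q)) →
                  WellOrdered P
    wellOrdered {p} {P} max (m , pm) = stable λ ¬acc →
      let (n , (pn , ¬accn) , n-max) = max Bad proj₁ (m , pm , ¬acc)
      in ¬accn (acc λ {(o , po)} o≻n →
           stable λ ¬acco → n-max o (po , ¬acco) o≻n)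
      where
      Bad : Pred Monomial (κ ⊔ p)
      Bad m = Σ (P m) λ pm → ¬ Acc {A = ∃ P} (_≻ᴺ_ on proj₁) (m , pm)

    wellOrdered-∪ : ∀ {p q} {P : Pred Monomial p} {Q : Pred Monomial q} →
                    WellOrdered P → WellOrdered Q → WellOrdered (P ∪ Q)
    wellOrdered-∪ {p} {q} {P} {Q} wP wQ = wellOrdered max
      where
      max : (S : Pred Monomial (κ ⊔ p ⊔ q)) → S ⊆ (P ∪ Q) → ∃ S → ∃ (IsMaximumOf S)
      max S S⊆ (s , Ss) with decide (∃ λ m → S m × P m) | decide (∃ λ m → S m × Q m)
      ... | no ¬p | no ¬q = ⊥-elim ([ (λ ps → ¬p (s , Ss , ps)) , (λ qs → ¬q (s , Ss , qs)) ]′ (S⊆ Ss))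
      ... | yes p | no ¬q with maximum (wellOrdered-⊆ proj₂ wP) p
      ...   | m , (Sm , _) , m-max = m , Sm , λ n Sn →
                [ (λ pn → m-max n (Sn , pn)) , (λ qn → ⊥-elim (¬q (n , Sn , qn))) ]′ (S⊆ Sn)
      max S S⊆ (s , Ss) | no ¬p | yes q with maximum (wellOrdered-⊆ proj₂ wQ) q
      ...   | m , (Sm , _) , m-max = m , Sm , λ n Sn →
                [ (λ pn → ⊥-elim (¬p (n , Sn , pn))) , (λ qn → m-max n (Sn , qn)) ]′ (S⊆ Sn)
      max S S⊆ (s , Ss) | yes p | yes q
        with maximum (wellOrdered-⊆ proj₂ wP) p | maximum (wellOrdered-⊆ proj₂ wQ) q
      ... | m , (Sm , _) , m-max | n , (Sn , _) , n-max with decide (m ≺ᴺ n)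
      ...   | yes m≺n = n , Sn , λ o So →
                [ (λ po → 𝔑.≼-trans (m-max o (So , po)) (𝔑.≺⇒≼ m≺n)) , (λ qo → n-max o (So , qo)) ]′ (S⊆ So)
      ...   | no  m⊀n = m , Sm , λ o So →
                [ (λ po → m-max o (So , po)) , (λ qo → 𝔑.≼-trans (n-max o (So , qo)) m⊀n) ]′ (S⊆ So)

  _·_ : Pred Monomial p → Pred Monomial q → Pred Monomial (κ ⊔ p ⊔ q)
  (P · Q) m = ∃ λ a → ∃ λ b → P a × Q b × m 𝔑.≈ a ∙ b

  abstract
    wellOrdered-· : ∀ {p q} {P : Pred Monomial p} {Q : Pred Monomial q} →
                    WellOrdered P → WellOrdered Q → WellOrdered (P · Q)
    wellOrdered-· {p} {q} {P} {Q} wP wQ = wellOrdered max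
      where
      module _ (S : Pred Monomial (κ ⊔ p ⊔ q)) (S⊆ : S ⊆ (P · Q)) where
        -- The first factors of the elements of S above c.
        First : Monomial → Pred Monomial (κ ⊔ p ⊔ q)
        First c a = P a × ∃ λ b → ∃ λ s → Q b × S s × c ≺ᴺ s × s 𝔑.≈ a ∙ b

        AnyFirst : Pred Monomial (κ ⊔ p ⊔ q)
        AnyFirst a = P a × ∃ λ b → ∃ λ s → Q b × S s × s 𝔑.≈ a ∙ b

        go : ∀ b (qb : Q b) → Acc {A = ∃ Q} (_≻ᴺ_ on proj₁) (b , qb) →
             ∀ a s → S s → s 𝔑.≈ a ∙ b → (∀ a′ → First s a′ → a′ ≼ᴺ a) →
             ∃ (IsMaximumOf S)
        go b qb (acc rs) a s Ss s≈ab bound with decide (∃ λ t → S t × s ≺ᴺ t)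
        ... | no  none = s , Ss , λ t St s≺t → none (t , St , s≺t)
        ... | yes (t , St , s≺t)
          with (a′ , b′ , pa′ , qb′ , t≈) ← S⊆ St
          with maximum {P = First s} (wellOrdered-⊆ proj₁ wP) (a′ , pa′ , b′ , t , qb′ , St , s≺t , t≈)
        ...   | a₁ , first@(_ , b₁ , s₁ , qb₁ , Ss₁ , s≺s₁ , s₁≈) , a₁-max =
          go b₁ qb₁ (rs b≺b₁) a₁ s₁ Ss₁ s₁≈ λ a″ (pa″ , b″ , s″ , qb″ , Ss″ , s₁≺s″ , s″≈) →
            a₁-max a″ (pa″ , b″ , s″ , qb″ , Ss″ , 𝔑.Order.trans s≺s₁ s₁≺s″ , s″≈)
          where
          b≺b₁ : b ≺ᴺ b₁
          b≺b₁ = stable λ b₁≼b → 𝔑.∙-mono-≼ (bound a₁ first) b₁≼b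
            (𝔑.Order.<-respˡ-≈ s≈ab (𝔑.Order.<-respʳ-≈ s₁≈ s≺s₁))

      max : (S : Pred Monomial (κ ⊔ p ⊔ q)) → S ⊆ (P · Q) → ∃ S → ∃ (IsMaximumOf S)
      max S S⊆ (s , Ss)
        with (a , b , pa , qb , s≈) ← S⊆ Ss
        with maximum {P = AnyFirst S S⊆} (wellOrdered-⊆ proj₁ wP) (a , pa , b , s , qb , Ss , s≈)
      ... | a₁ , (_ , b₁ , s₁ , qb₁ , Ss₁ , s₁≈) , a₁-max =
        go S S⊆ b₁ qb₁ (wQ (b₁ , qb₁)) a₁ s₁ Ss₁ s₁≈
          λ a″ (pa″ , b″ , s″ , qb″ , Ss″ , _ , s″≈) → a₁-max a″ (pa″ , b″ , s″ , qb″ , Ss″ , s″≈)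

    isSmall-⊆ : {P : Pred Monomial p} {Q : Pred Monomial q} → Q ⊆ P → IsSmall P → IsSmall Q
    isSmall-⊆ Q⊆P (J , e , cover) = J , e , λ m qm → cover m (Q⊆P qm)

    isSmall-∪ : {P : Pred Monomial p} {Q : Pred Monomial q} → IsSmall P → IsSmall Q → IsSmall (P ∪ Q)
    isSmall-∪ {P = P} {Q} (J , e , cover) (K , f , cover′) = (J ⊎ K) , [ e , f ]′ , cover-∪
      where
      cover-∪ : ∀ m → (P ∪ Q) m → ∃ λ k → m 𝔑.≈ [ e , f ]′ k
      cover-∪ m (inj₁ pm) = let (k , eq) = cover  m pm in inj₁ k , eq
      cover-∪ m (inj₂ qm) = let (k , eq) = cover′ m qm in inj₂ k , eq

    isSmall-· : {P : Pred Monomial p} {Q : Pred Monomial q} → IsSmall P → IsSmall Q → IsSmall (P · Q)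
    isSmall-· (J , e , cover) (K , f , cover′) = (J × K) , (λ (k , l) → e k ∙ f l) ,
      λ m (a , b , pa , qb , m≈ab) →
        let (k , a≈) = cover a pa ; (l , b≈) = cover′ b qb
        in (k , l) , 𝔑.trans m≈ab (𝔑.∙-cong a≈ b≈)

  private
    -- A class that is well-ordered by both ≻ᴺ and ≺ᴺ is finite.
    module _ where
      open SetoidMembership 𝔑.setoid using (_∈_)
      open SetoidUnique 𝔑.setoid using (Unique)

      abstract
        finite : {P : Pred Monomial p} → WellOrdered P → WellFounded {A = ∃ P} (_≺ᴺ_ on proj₁) →
                 ∃ λ L → Unique L × (∀ m → P m → m ∈ L)
        finite {P = P} w≻ w≺ with decide (∃ P)
        ... | no none = [] , [] , λ m pm → ⊥-elim (none (m , pm))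
        ... | yes p with least w≺ p
        ...   | m , pm , m-min with go m pm (w≻ (m , pm))
          where
          go : ∀ m pm → Acc {A = ∃ P} (_≻ᴺ_ on proj₁) (m , pm) →
               ∃ λ L → Unique L × (∀ n → P n → m ≼ᴺ n → n ∈ L) × All (m ≼ᴺ_) L
          go m pm (acc rs) with decide (∃ λ n → P n × m ≺ᴺ n)
          ... | no none = m ∷ [] , [] ∷ [] ,
                  (λ n pn m≼n → [ (λ m≺n → ⊥-elim (none (n , pn , m≺n)))
                                , (λ m≈n → here (𝔑.sym m≈n)) ]′ (𝔑.≼⇒≺⊎≈ m≼n)) ,
                  𝔑.≈⇒≼ 𝔑.refl ∷ []
          ... | yes above with least (pull proj₁ w≺) above
          ...   | n , (pn , m≺n) , n-min with go n pn (rs m≺n)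
          ...     | L , uL , cover , bound =
                    m ∷ L ,
                    All.map (λ n≼o m≈o → n≼o (𝔑.Order.<-respˡ-≈ m≈o m≺n)) bound ∷ uL ,
                    (λ o po m≼o → [ (λ m≺o → there (cover o po (n-min o (po , m≺o))))
                                  , (λ m≈o → here (𝔑.sym m≈o)) ]′ (𝔑.≼⇒≺⊎≈ m≼o)) ,
                    𝔑.≈⇒≼ 𝔑.refl ∷ All.map (𝔑.≼-trans (𝔑.≺⇒≼ m≺n)) bound
        ...     | L , uL , cover , _ = L , uL , λ n pn → cover n pn (m-min n pn)

  record Series : Set (κ ⊔ lsuc σ) where
    field
      coeff      : Monomial → R.Carrier
      coeff-cong : ∀ {m n} → m 𝔑.≈ n → coeff m R.≈ coeff n

    supp : Pred Monomial κ
    supp m = ¬ coeff m R.≈ R.0#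

    field
      supp-small       : IsSmall supp
      supp-wellOrdered : WellOrdered supp

  open Series public

  infix 4 _≈_
  _≈_ : Rel Series κ
  s ≈ t = ∀ m → coeff s m R.≈ coeff t m

  seriesSetoid : Setoid (κ ⊔ lsuc σ) κ
  seriesSetoid = record
    { Carrier       = Series
    ; _≈_           = _≈_
    ; isEquivalence = record
      { refl  = λ m → R.refl
      ; sym   = λ s≈t m → R.sym (s≈t m)
      ; trans = λ s≈t t≈u m → R.trans (s≈t m) (t≈u m)
      }
    }

  Family : ∀ {i j} → Setoid i j → Set (i ⊔ j ⊔ κ ⊔ lsuc σ)
  Family I = Func I seriesSetoid

  module _ {I : Setoid i j} where
    private module I = Setoid I
    open FiniteSum R I

    record Summable (s : Family I) : Set (i ⊔ j ⊔ κ ⊔ lsuc σ) where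
      field
        ⋃supp-small       : IsSmall (λ m → ∃ λ k → supp (s ⟨$⟩ k) m)
        ⋃supp-wellOrdered : WellOrdered (λ m → ∃ λ k → supp (s ⟨$⟩ k) m)
        pointFinite       : ∀ m → FinitelySupported (λ k → coeff (s ⟨$⟩ k) m)

    ∑ : (s : Family I) → Summable s → Series
    ∑ s S = record
      { coeff            = λ m → finSum (λ k → coeff (s ⟨$⟩ k) m) (pointFinite m)
      ; coeff-cong       = λ {m} {n} m≈n → finSum-cong r≟0 (λ k≈l → Func.cong s k≈l n)
                             (λ k → coeff-cong (s ⟨$⟩ k) m≈n) (pointFinite m) (pointFinite n)
      ; supp-small       = isSmall-⊆ (nonzero _) ⋃supp-small
      ; supp-wellOrdered = wellOrdered-⊆ (nonzero _) ⋃supp-wellOrdered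
      }
      where
      open Summable S
      nonzero : ∀ m → ¬ finSum (λ k → coeff (s ⟨$⟩ k) m) (pointFinite m) R.≈ R.0# →
                ∃ λ k → supp (s ⟨$⟩ k) m
      nonzero m ≉0 = stable λ none → ≉0 (finSum-cong r≟0 (λ _ → R.refl)
        (λ k → stable λ sk≉0 → none (k , sk≉0)) (pointFinite m)
        ([] , [] , λ k 0≉0 → ⊥-elim (0≉0 R.refl)))

    HasSum : Family I → Series → Set (i ⊔ j ⊔ κ ⊔ lsuc σ)
    HasSum s t = Σ (Summable s) λ S → ∑ s S ≈ t

  single : R.Carrier → Monomial → Series
  single r m = record
    { coeff            = λ n → if n
    ; coeff-cong       = λ {n} {o} n≈o → if-cong n≈o
    ; supp-small       = isSmall-⊆ if-supp (Lift-⊤ , (λ _ → m) , λ n n≈m → lift tt , n≈m)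
    ; supp-wellOrdered = wellOrdered-⊆ if-supp λ (n , n≈m) →
        acc λ {(o , o≈m)} n≺o → ⊥-elim (𝔑.Order.irrefl (𝔑.trans n≈m (𝔑.sym o≈m)) n≺o)
    }
    where
    Lift-⊤ : Set σ
    Lift-⊤ = Lift σ ⊤
    if : Monomial → R.Carrier
    if n with n 𝔑.Order.≟ m
    ... | yes _ = r
    ... | no  _ = R.0#
    if-cong : ∀ {n o} → n 𝔑.≈ o → if n R.≈ if o
    if-cong {n} {o} n≈o with n 𝔑.Order.≟ m | o 𝔑.Order.≟ m
    ... | yes _   | yes _   = R.refl
    ... | yes n≈m | no  o≉m = ⊥-elim (o≉m (𝔑.trans (𝔑.sym n≈o) n≈m))
    ... | no  n≉m | yes o≈m = ⊥-elim (n≉m (𝔑.trans n≈o o≈m))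
    ... | no  _   | no  _   = R.refl
    if-supp : ∀ {n} → ¬ if n R.≈ R.0# → n 𝔑.≈ m
    if-supp {n} ≉0 with n 𝔑.Order.≟ m
    ... | yes n≈m = n≈m
    ... | no  _   = ⊥-elim (≉0 R.refl)

  abstract
    single-≈ : ∀ r {m n} → n 𝔑.≈ m → coeff (single r m) n R.≈ r
    single-≈ r {m} {n} n≈m with n 𝔑.Order.≟ m
    ... | yes _   = R.refl
    ... | no  n≉m = ⊥-elim (n≉m n≈m)

    single-≉ : ∀ r {m n} → ¬ n 𝔑.≈ m → coeff (single r m) n R.≈ R.0#
    single-≉ r {m} {n} n≉m with n 𝔑.Order.≟ m
    ... | yes n≈m = ⊥-elim (n≉m n≈m)
    ... | no  _   = R.refl

    single-cong : ∀ r {m n} → m 𝔑.≈ n → single r m ≈ single r n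
    single-cong r {m} {n} m≈n o with o 𝔑.Order.≟ m | o 𝔑.Order.≟ n
    ... | yes _   | yes _   = R.refl
    ... | yes o≈m | no  o≉n = ⊥-elim (o≉n (𝔑.trans o≈m m≈n))
    ... | no  o≉m | yes o≈n = ⊥-elim (o≉m (𝔑.trans o≈n (𝔑.sym m≈n)))
    ... | no  _   | no  _   = R.refl

  const : R.Carrier → Series
  const r = single r ε

  abstract
    const-cong : ∀ {r q} → r R.≈ q → const r ≈ const q
    const-cong r≈q m with m 𝔑.Order.≟ ε
    ... | yes _ = r≈q
    ... | no  _ = R.refl

  mono : Monomial → Series
  mono m = single R.1# m

  abstract
    mono-cong : ∀ {m n} → m 𝔑.≈ n → mono m ≈ mono n
    mono-cong = single-cong R.1#

  0# 1# : Series
  0# = const R.0#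
  1# = const R.1#

  abstract
    0#-coeff : ∀ m → coeff 0# m R.≈ R.0#
    0#-coeff m with decide (m 𝔑.≈ ε)
    ... | yes m≈ε = single-≈ R.0# m≈ε
    ... | no  m≉ε = single-≉ R.0# m≉ε

  infix  8 -_
  infixl 7 _*_
  infixr 7 _•_
  infixl 6 _+_ _-_

  _+_ : Series → Series → Series
  s + t = record
    { coeff            = λ m → coeff s m R.+ coeff t m
    ; coeff-cong       = λ m≈n → R.+-cong (coeff-cong s m≈n) (coeff-cong t m≈n)
    ; supp-small       = isSmall-⊆ (λ {m} → split m) (isSmall-∪ (supp-small s) (supp-small t))
    ; supp-wellOrdered = wellOrdered-⊆ (λ {m} → split m)
                           (wellOrdered-∪ (supp-wellOrdered s) (supp-wellOrdered t))
    }
    where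
    split : ∀ m → ¬ coeff s m R.+ coeff t m R.≈ R.0# → supp s m ⊎ supp t m
    split m ≉0 with r≟0 (coeff s m)
    ... | no  s≉0 = inj₁ s≉0
    ... | yes s≈0 = inj₂ λ t≈0 → ≉0 (R.trans (R.+-cong s≈0 t≈0) (R.+-identityˡ R.0#))

  -_ : Series → Series
  - s = record
    { coeff            = λ m → R.- coeff s m
    ; coeff-cong       = λ m≈n → R.-‿cong (coeff-cong s m≈n)
    ; supp-small       = isSmall-⊆ ⊆supp (supp-small s)
    ; supp-wellOrdered = wellOrdered-⊆ ⊆supp (supp-wellOrdered s)
    }
    where
    ⊆supp : ∀ {m} → ¬ R.- coeff s m R.≈ R.0# → supp s m
    ⊆supp ≉0 s≈0 = ≉0 (R.trans (R.-‿cong s≈0) R.-0#≈0#)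

  _-_ : Series → Series → Series
  s - t = s + (- t)

  _•_ : R.Carrier → Series → Series
  r • s = record
    { coeff            = λ m → r R.* coeff s m
    ; coeff-cong       = λ m≈n → R.*-congˡ (coeff-cong s m≈n)
    ; supp-small       = isSmall-⊆ ⊆supp (supp-small s)
    ; supp-wellOrdered = wellOrdered-⊆ ⊆supp (supp-wellOrdered s)
    }
    where
    ⊆supp : ∀ {m} → ¬ r R.* coeff s m R.≈ R.0# → supp s m
    ⊆supp ≉0 s≈0 = ≉0 (R.trans (R.*-congˡ s≈0) (R.zeroʳ r))

  -- The Cauchy product: the coefficient of s * t at m is the sum of the
  -- coeff s a · coeff t b over all a, b with a ∙ b = m, that is, b = a⁻¹ ∙ m.

  a∙a⁻¹m : ∀ a m → m 𝔑.≈ a ∙ (a ⁻¹ ∙ m)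
  a∙a⁻¹m a m = 𝔑.sym (𝔑.trans (𝔑.sym (𝔑.assoc a (a ⁻¹) m))
    (𝔑.trans (𝔑.∙-congʳ (𝔑.inverseʳ a)) (𝔑.identityˡ m)))

  module Cauchy = FiniteSum R 𝔑.setoid

  term : Series → Series → Monomial → Monomial → R.Carrier
  term s t m a = coeff s a R.* coeff t (a ⁻¹ ∙ m)

  abstract
    term-congˡ : ∀ s t m {a b} → a 𝔑.≈ b → term s t m a R.≈ term s t m b
    term-congˡ s t m a≈b =
      R.*-cong (coeff-cong s a≈b) (coeff-cong t (𝔑.∙-congʳ (𝔑.⁻¹-cong a≈b)))

    term-factors : ∀ s t m {a} → ¬ term s t m a R.≈ R.0# → supp s a × supp t (a ⁻¹ ∙ m)
    term-factors s t m ≉0 =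
      (λ s≈0 → ≉0 (R.trans (R.*-congʳ s≈0) (R.zeroˡ _))) ,
      (λ t≈0 → ≉0 (R.trans (R.*-congˡ t≈0) (R.zeroʳ _)))

    term-finite : ∀ s t m → Cauchy.FinitelySupported (term s t m)
    term-finite s t m =
      let (L , uL , cover) = finite
            {P = λ a → supp s a × supp t (a ⁻¹ ∙ m)}
            (wellOrdered-⊆ proj₁ (supp-wellOrdered s))
            (Subrelation.wellFounded (λ a≺b → 𝔑.∙-monoˡ-≺ m (𝔑.⁻¹-anti-≺ a≺b))
              (On.wellFounded (λ (a , _ , t≉0) → a ⁻¹ ∙ m , t≉0) (supp-wellOrdered t)))
      in L , uL , λ a ≉0 → cover a (term-factors s t m ≉0)

  _*_ : Series → Series → Series
  s * t = record
    { coeff            = λ m → Cauchy.finSum (term s t m) (term-finite s t m)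
    ; coeff-cong       = λ {m} {n} m≈n → Cauchy.finSum-cong r≟0 (term-congˡ s t n)
                           (λ a → R.*-congˡ (coeff-cong t (𝔑.∙-congˡ m≈n)))
                           (term-finite s t m) (term-finite s t n)
    ; supp-small       = isSmall-⊆ (λ {m} → split m) (isSmall-· (supp-small s) (supp-small t))
    ; supp-wellOrdered = wellOrdered-⊆ (λ {m} → split m)
                           (wellOrdered-· (supp-wellOrdered s) (supp-wellOrdered t))
    }
    where
    split : ∀ m → ¬ Cauchy.finSum (term s t m) (term-finite s t m) R.≈ R.0# →
            (supp s · supp t) m
    split m ≉0 = stable λ none → ≉0 (Cauchy.finSum-cong r≟0 (λ _ → R.refl)
      (λ a → stable λ st≉0 → let (s≉0 , t≉0) = term-factors s t m st≉0 in
        none (a , a ⁻¹ ∙ m , s≉0 , t≉0 , a∙a⁻¹m a m))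
      (term-finite s t m) ([] , [] , λ _ 0≉0 → ⊥-elim (0≉0 R.refl)))

  abstract
    *-cong : ∀ {s t u v} → s ≈ t → u ≈ v → s * u ≈ t * v
    *-cong {s} {t} {u} {v} s≈t u≈v m = Cauchy.finSum-cong r≟0 (term-congˡ t v m)
      (λ a → R.*-cong (s≈t a) (u≈v (a ⁻¹ ∙ m))) (term-finite s u m) (term-finite t v m)

  rawRing : RawRing (κ ⊔ lsuc σ) κ
  rawRing = record
    { Carrier = Series ; _≈_ = _≈_ ; _+_ = _+_ ; _*_ = _*_ ; -_ = -_ ; 0# = 0# ; 1# = 1# }

  rawLeftModule : RawLeftModule R.Carrier (κ ⊔ lsuc σ) κ
  rawLeftModule = record
    { Carrierᴹ = Series ; _≈ᴹ_ = _≈_ ; _+ᴹ_ = _+_ ; _*ₗ_ = _•_ ; 0ᴹ = 0# ; -ᴹ_ = -_ }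

  open RawSemiringDefs (RawRing.rawSemiring rawRing) public using (_^_)

  infix 4 _<_ _≤_

  -- IsDominantMonomial s m expresses m = 𝔡(s).
  IsDominantMonomial : Series → Monomial → Set κ
  IsDominantMonomial s = IsMaximumOf (supp s)

  Positive : Series → Set κ
  Positive s = ∃ λ m → IsDominantMonomial s m × R.0# R.< coeff s m

  _<_ _≤_ : Rel Series κ
  s < t = Positive (t - s)
  s ≤ t = s < t ⊎ s ≈ t

  abstract
    positive-resp : ∀ {s t} → s ≈ t → Positive s → Positive t
    positive-resp s≈t (m , (s≉0 , s-max) , 0<s) =
      m , ((λ t≈0 → s≉0 (R.trans (s≈t m) t≈0)) ,
           λ n t≉0 → s-max n λ s≈0 → t≉0 (R.trans (R.sym (s≈t n)) s≈0)) ,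
      R.Order.<-respʳ-≈ (s≈t m) 0<s

    ≉0⇒pos⊎neg : ∀ {s} → ¬ s ≈ 0# → Positive s ⊎ Positive (- s)
    ≉0⇒pos⊎neg {s} s≉0
      with m , (sm≉0 , m-max) ← maximum (supp-wellOrdered s)
             (stable λ none → s≉0 λ n →
                R.trans (stable λ sn≉0 → none (n , sn≉0)) (R.sym (0#-coeff n)))
      with R.Order.compare (coeff s m) R.0#
    ... | tri< s<0 _ _ = inj₂ (m ,
            ( (λ -s≈0 → R.pos⇒≉0 (R.neg⇒-pos s<0) -s≈0)
            , λ n -s≉0 → m-max n λ s≈0 → -s≉0 (R.trans (R.-‿cong s≈0) R.-0#≈0#)) ,
            R.neg⇒-pos s<0)
    ... | tri≈ _ s≈0 _ = ⊥-elim (sm≉0 s≈0)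
    ... | tri> _ _ 0<s = inj₁ (m , (sm≉0 , m-max) , 0<s)

    private
      beyond : ∀ s {m n} → (∀ o → supp s o → o ≼ᴺ m) → m ≺ᴺ n → coeff s n R.≈ R.0#
      beyond s max m≺n = stable λ s≉0 → max _ s≉0 m≺n

      positive-at : ∀ s m → R.0# R.< coeff s m → (∀ n → m ≺ᴺ n → coeff s n R.≈ R.0#) → Positive s
      positive-at s m 0<s vanish = m , (R.pos⇒≉0 0<s , λ n s≉0 m≺n → s≉0 (vanish n m≺n)) , 0<s

    positive-+ : ∀ {s t} → Positive s → Positive t → Positive (s + t)
    positive-+ {s} {t} (m , (_ , m-max) , 0<s) (n , (_ , n-max) , 0<t) with 𝔑.Order.compare m n
    ... | tri< m≺n _ _ = positive-at (s + t) n
            (R.Order.<-respʳ-≈ (R.sym (R.trans (R.+-congʳ (beyond s m-max m≺n)) (R.+-identityˡ _))) 0<t)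
            λ o n≺o → R.trans (R.+-cong (beyond s m-max (𝔑.Order.trans m≺n n≺o)) (beyond t n-max n≺o))
                              (R.+-identityˡ R.0#)
    ... | tri≈ _ m≈n _ = positive-at (s + t) m
            (R.+-pos 0<s (R.Order.<-respʳ-≈ (coeff-cong t (𝔑.sym m≈n)) 0<t))
            λ o m≺o → R.trans (R.+-cong (beyond s m-max m≺o) (beyond t n-max (𝔑.Order.<-respˡ-≈ m≈n m≺o)))
                              (R.+-identityˡ R.0#)
    ... | tri> _ _ n≺m = positive-at (s + t) m
            (R.Order.<-respʳ-≈ (R.sym (R.trans (R.+-congˡ (beyond t n-max n≺m)) (R.+-identityʳ _))) 0<s)
            λ o m≺o → R.trans (R.+-cong (beyond s m-max m≺o) (beyond t n-max (𝔑.Order.trans n≺m m≺o)))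
                              (R.+-identityˡ R.0#)

    positive-* : ∀ {s t} → Positive s → Positive t → Positive (s * t)
    positive-* {s} {t} (m , (_ , m-max) , 0<s) (n , (_ , n-max) , 0<t) =
      positive-at (s * t) (m ∙ n) (R.Order.<-respʳ-≈ (R.sym lead) (R.*-pos 0<s 0<t)) vanish
      where
      mn≺ab : ∀ {a b} → supp s a → supp t b → ¬ m ∙ n ≺ᴺ a ∙ b
      mn≺ab sa tb = 𝔑.∙-mono-≼ (m-max _ sa) (n-max _ tb)

      vanish : ∀ o → m ∙ n ≺ᴺ o → coeff (s * t) o R.≈ R.0#
      vanish o mn≺o = Cauchy.finSum-cong r≟0 (λ _ → R.refl)
        (λ a → stable λ ≉0 → let (sa , tb) = term-factors s t o ≉0 in
          mn≺ab sa tb (𝔑.Order.<-respʳ-≈ (a∙a⁻¹m a o) mn≺o))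
        (term-finite s t o) ([] , [] , λ _ 0≉0 → ⊥-elim (0≉0 R.refl))

      m⁻¹mn : m ⁻¹ ∙ (m ∙ n) 𝔑.≈ n
      m⁻¹mn = 𝔑.trans (𝔑.sym (𝔑.assoc (m ⁻¹) m n))
        (𝔑.trans (𝔑.∙-congʳ (𝔑.inverseˡ m)) (𝔑.identityˡ n))

      only-m : ∀ a → ¬ term s t (m ∙ n) a R.≈ R.0# → a 𝔑.≈ m
      only-m a ≉0 with (sa , tb) ← term-factors s t (m ∙ n) ≉0
                  with 𝔑.≼⇒≺⊎≈ (m-max a sa)
      ... | inj₂ a≈m = a≈m
      ... | inj₁ a≺m = ⊥-elim (𝔑.Order.irrefl (𝔑.sym (a∙a⁻¹m a (m ∙ n)))
                         (𝔑.∙-mono-≺-≼ a≺m (n-max _ tb)))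

      lead : coeff (s * t) (m ∙ n) R.≈ coeff s m R.* coeff t n
      lead = R.trans
        (Cauchy.finSum-cong r≟0 (term-congˡ s t (m ∙ n)) (λ _ → R.refl) (term-finite s t (m ∙ n))
          (m ∷ [] , [] ∷ [] , λ a ≉0 → here (only-m a ≉0)))
        (R.trans (R.+-identityʳ _) (R.*-congˡ (coeff-cong t m⁻¹mn)))

    positive-• : ∀ {r s} → R.0# R.< r → Positive s → Positive (r • s)
    positive-• {r} {s} 0<r (m , (_ , m-max) , 0<s) = positive-at (r • s) m (R.*-pos 0<r 0<s)
      λ n m≺n → R.trans (R.*-congˡ (beyond s m-max m≺n)) (R.zeroʳ r)

    private
      single-positive : ∀ {r} m → R.0# R.< r → Positive (single r m)
      single-positive {r} m 0<r = positive-at (single r m) m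
        (R.Order.<-respʳ-≈ (R.sym (single-≈ r 𝔑.refl)) 0<r)
        λ n m≺n → single-≉ r λ n≈m → 𝔑.Order.irrefl (𝔑.sym n≈m) m≺n

    const-positive : ∀ {r} → R.0# R.< r → Positive (const r)
    const-positive = single-positive ε

    mono-positive : ∀ m → Positive (mono m)
    mono-positive m = single-positive m R.0<1

    ¬0-positive : ∀ {s} → s ≈ 0# → ¬ Positive s
    ¬0-positive s≈0 (m , (s≉0 , _) , _) = s≉0 (R.trans (s≈0 m) (0#-coeff m))

  𝕋× 𝕋⁺ 𝕋>R : Set (κ ⊔ lsuc σ)
  𝕋×  = Σ Series λ s → ¬ s ≈ 0#
  𝕋⁺  = Σ Series Positive
  𝕋>R = Σ Series λ s → ∀ r → const r < s

  𝕋⁺⇒𝕋× : 𝕋⁺ → 𝕋×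
  𝕋⁺⇒𝕋× (s , s>0) = s , λ s≈0 → ¬0-positive {s} s≈0 s>0

  𝕋⁺-rawMonoid : RawMonoid (κ ⊔ lsuc σ) κ
  𝕋⁺-rawMonoid = record
    { Carrier = 𝕋⁺
    ; _≈_     = _≈_ on proj₁
    ; _∙_     = λ (s , s>0) (t , t>0) → s * t , positive-* {s} {t} s>0 t>0
    ; ε       = 1# , const-positive R.0<1
    }

  R⁺ : Set κ
  R⁺ = Σ R.Carrier λ r → R.0# R.< r

  R⁺-rawMonoid : RawMonoid κ κ
  R⁺-rawMonoid = record
    { Carrier = R⁺
    ; _≈_     = R._≈_ on proj₁
    ; _∙_     = λ (r , r>0) (q , q>0) → r R.* q , R.*-pos r>0 q>0
    ; ε       = R.1# , R.0<1
    }

  const⁺ : R⁺ → 𝕋⁺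
  const⁺ (r , r>0) = const r , const-positive r>0

  mono⁺ : Monomial → 𝕋⁺
  mono⁺ m = mono m , mono-positive m

  mono× : Monomial → 𝕋×
  mono× m = 𝕋⁺⇒𝕋× (mono⁺ m)

  ∣_∣ : Series → Series
  ∣ s ∣ with decide (Positive (- s))
  ... | yes _ = - s
  ... | no  _ = s

  ∣_∣⁺ : 𝕋× → 𝕋⁺
  ∣ s , s≉0 ∣⁺ = ∣ s ∣ , positive
    where
    positive : Positive ∣ s ∣
    positive with decide (Positive (- s)) | ≉0⇒pos⊎neg {s} s≉0
    ... | yes -s>0 | _         = -s>0
    ... | no  _    | inj₁ s>0  = s>0
    ... | no  ¬neg | inj₂ -s>0 = ⊥-elim (¬neg -s>0)

  infix 4 _≺_ _≼_

  _≺_ _≼_ : Rel Series κ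
  s ≺ t = ∀ r → R.0# R.< r → r • ∣ s ∣ < ∣ t ∣
  s ≼ t = ¬ t ≺ s

  abstract
    ∣∣-cases : ∀ s → (Positive (- s) × ∣ s ∣ ≡ - s) ⊎ (¬ Positive (- s) × ∣ s ∣ ≡ s)
    ∣∣-cases s with decide (Positive (- s))
    ... | yes -s>0 = inj₁ (-s>0 , ≡.refl)
    ... | no ¬-s>0 = inj₂ (¬-s>0 , ≡.refl)

    ∣∣-positive : ∀ {s} → Positive s → ∣ s ∣ ≡ s
    ∣∣-positive {s} s>0 with ∣∣-cases s
    ... | inj₂ (_ , eq)   = eq
    ... | inj₁ (-s>0 , _) = ⊥-elim (¬0-positive {s + - s}
            (λ m → R.trans (R.-‿inverseʳ _) (R.sym (0#-coeff m))) (positive-+ {s} { - s} s>0 -s>0))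

    ¬neg⇒≥0 : ∀ {s} → ¬ Positive (- s) → s ≈ 0# ⊎ Positive s
    ¬neg⇒≥0 {s} ¬neg with decide (s ≈ 0#)
    ... | yes s≈0 = inj₁ s≈0
    ... | no  s≉0 = inj₂ ([ (λ s>0 → s>0) , (λ neg → ⊥-elim (¬neg neg)) ]′ (≉0⇒pos⊎neg {s} s≉0))

    positive-+-≥0 : ∀ {s t} → Positive s → t ≈ 0# ⊎ Positive t → Positive (s + t)
    positive-+-≥0 {s} {t} s>0 (inj₂ t>0) = positive-+ {s} {t} s>0 t>0
    positive-+-≥0 {s} {t} s>0 (inj₁ t≈0) = positive-resp {s} {s + t} (λ m → R.sym
      (R.trans (R.+-congˡ (R.trans (t≈0 m) (0#-coeff m))) (R.+-identityʳ _))) s>0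

    -r*-d : ∀ r d → R.- (r R.* R.- d) R.≈ r R.* d
    -r*-d r d = R.trans (R.-‿cong (R.sym (R.-‿distribʳ-* r d))) (R.-‿involutive _)

    const-• : ∀ q r m → coeff (const (q R.* r)) m R.≈ q R.* coeff (const r) m
    const-• q r m with decide (m 𝔑.≈ ε)
    ... | yes m≈ε = R.trans (single-≈ _ m≈ε) (R.*-congˡ (R.sym (single-≈ r m≈ε)))
    ... | no  m≉ε = R.trans (single-≉ _ m≉ε)
            (R.sym (R.trans (R.*-congˡ (single-≉ r m≉ε)) (R.zeroʳ q)))

  2# : R.Carrier
  2# = R.1# R.+ R.1#

  abstract
    0<2 : R.0# R.< 2#
    0<2 = R.+-pos R.0<1 R.0<1

    halving : ∀ s {s′ d c c′} → s′ R.≈ s → c′ R.≈ 2# R.* c →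
              (s′ R.+ R.- (2# R.* R.- d)) R.+ (s R.+ R.- c′) R.≈ 2# R.* (s R.+ d R.+ R.- c)
    halving s {s′} {d} {c} {c′} s′≈s c′≈2c = begin
      (s′ R.+ R.- (2# R.* R.- d)) R.+ (s R.+ R.- c′)
        ≈⟨ R.+-cong (R.+-cong s′≈s (-r*-d 2# d)) (R.+-congˡ (R.trans (R.-‿cong c′≈2c) (R.-‿distribʳ-* 2# c))) ⟩
      (s R.+ 2# R.* d) R.+ (s R.+ 2# R.* (R.- c))
        ≈⟨ interchange s (2# R.* d) s (2# R.* (R.- c)) ⟩
      (s R.+ s) R.+ (2# R.* d R.+ 2# R.* (R.- c))
        ≈⟨ R.+-cong (R.sym (R.trans (R.distribʳ s R.1# R.1#) (R.+-cong (R.*-identityˡ s) (R.*-identityˡ s))))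
                    (R.sym (R.distribˡ 2# d (R.- c))) ⟩
      2# R.* s R.+ 2# R.* (d R.+ R.- c)
        ≈⟨ R.distribˡ 2# s (d R.+ R.- c) ⟨
      2# R.* (s R.+ (d R.+ R.- c))
        ≈⟨ R.*-congˡ (R.+-assoc s d (R.- c)) ⟨
      2# R.* (s R.+ d R.+ R.- c)
        ∎
      where
      open SetoidReasoning R.setoid
      open CommutativeSemigroupProperties R.+-commutativeSemigroup using (interchange)

    positive-halve : ∀ {s} → Positive (2# • s) → Positive s
    positive-halve {s} 2s>0 = [ (λ s>0 → s>0) , (λ neg → ⊥-elim (¬0-positive { (2# • s) + (2# • (- s))}
      (λ m → R.trans (R.sym (R.distribˡ 2# _ _))
        (R.trans (R.*-congˡ (R.-‿inverseʳ _)) (R.trans (R.zeroʳ 2#) (R.sym (0#-coeff m)))))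
      (positive-+ {2# • s} {2# • (- s)} 2s>0 (positive-• {2#} { - s} 0<2 neg)))) ]′
      (≉0⇒pos⊎neg {s} λ s≈0 → ¬0-positive {2# • s}
        (λ m → R.trans (R.*-congˡ (R.trans (s≈0 m) (0#-coeff m))) (R.trans (R.zeroʳ 2#) (R.sym (0#-coeff m)))) 2s>0)

    >R⇒positive : ∀ {s} → (∀ r → const r < s) → Positive s
    >R⇒positive {s} s>R = positive-resp {s - 0#} {s}
      (λ m → R.trans (R.+-congˡ (R.trans (R.-‿cong (0#-coeff m)) R.-0#≈0#)) (R.+-identityʳ _)) (s>R R.0#)

    1+-positive : ∀ {s} → s ≺ 1# → Positive (1# + s)
    1+-positive {s} s≺1 with ∣∣-cases s
    ... | inj₂ (¬neg , _) = positive-+-≥0 {1#} {s} (const-positive R.0<1) (¬neg⇒≥0 {s} ¬neg)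
    ... | inj₁ (_ , eq) with ∣ s ∣ | ∣ 1# ∣ | ∣∣-positive {1#} (const-positive R.0<1) | s≺1 R.1# R.0<1
    ...   | _ | _ | ≡.refl | 1-∣s∣>0 rewrite eq = positive-resp
              {1# - R.1# • (- s)} {1# + s} (λ m → R.+-congˡ (R.trans (-r*-d R.1# _) (R.*-identityˡ _))) 1-∣s∣>0

    >R-+ : ∀ {s δ} → (∀ r → const r < s) → δ ≺ s → ∀ r → const r < s + δ
    >R-+ {s} {δ} s>R δ≺s r with ∣∣-cases δ
    ... | inj₂ (¬neg , _) = positive-resp {(s - const r) + δ} {(s + δ) - const r}
            (λ m → R.trans (R.+-assoc _ _ _) (R.trans (R.+-congˡ (R.+-comm _ _)) (R.sym (R.+-assoc _ _ _))))
            (positive-+-≥0 {s - const r} {δ} (s>R r) (¬neg⇒≥0 {δ} ¬neg))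
    ... | inj₁ (_ , eq) = positive-halve {(s + δ) - const r}
            (positive-resp {(∣ s ∣ - 2# • ∣ δ ∣) + (s - const (2# R.* r))} {2# • ((s + δ) - const r)}
              (λ m → R.trans
                (R.+-congʳ (R.+-congˡ (R.-‿cong (R.*-congˡ (R.reflexive (≡.cong (λ t → coeff t m) eq))))))
                (halving (coeff s m) (R.reflexive (≡.cong (λ t → coeff t m) (∣∣-positive {s} (>R⇒positive {s} s>R)))) (const-• 2# r m)))
              (positive-+ {∣ s ∣ - 2# • ∣ δ ∣} {s - const (2# R.* r)} (δ≺s 2# 0<2) (s>R (2# R.* r))))

  record IsStronglyLinear (φ : Series → Series) : Set (lsuc κ ⊔ lsuc σ) where
    field
      isLinear : LeftModuleMorphisms.IsLeftModuleHomomorphism rawLeftModule rawLeftModule φ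

    cong : ∀ {s t} → s ≈ t → φ s ≈ φ t
    cong = LeftModuleMorphisms.IsLeftModuleHomomorphism.⟦⟧-cong isLinear

    map : {I : Setoid i j} → Family I → Family I
    map s = record { to = λ k → φ (s ⟨$⟩ k) ; cong = λ k≈l → cong (Func.cong s k≈l) }

    -- In universe κ there are enough index classes: up to terms equal to 0, a
    -- summable family can be reindexed by pairs of a monomial and a natural number.
    field
      summable : {I : Setoid κ κ} (s : Family I) → Summable s → Summable (map s)
      ∑-homo   : {I : Setoid κ κ} (s : Family I) (S : Summable s) →
                 φ (∑ s S) ≈ ∑ (map s) (summable s S)

  module _ (log : 𝕋⁺ → Series) where

    -- The index k stands for the exponent k + 1.
    logSeries : Series → Family (≡.setoid ℕ)
    logSeries s = record
      { to   = λ k → ((R.- R.1#) R.^ (suc k ℕ.+ 1) R.* R.1/ (suc k)) • s ^ suc k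
      ; cong = λ { ≡.refl m → R.refl }
      }

    -- 𝕋⁺ and R⁺ are groups, so monoid isomorphisms are group isomorphisms.
    record IsExponentiallyClosedTransserialField : Set (lsuc κ ⊔ lsuc σ) where
      field
        log-isMonoidIsomorphism :
          MonoidMorphisms.IsMonoidIsomorphism 𝕋⁺-rawMonoid (RawRing.+-rawMonoid rawRing) log
        log-isOrderIsomorphism :
          IsOrderIsomorphism (_≈_ on proj₁) _≈_ (_<_ on proj₁) _<_ log
        log-𝔑⊆𝕋≻ : ∀ m n → supp (log (mono⁺ m)) n → n ≻ᴺ ε
        log-≤     : ∀ s → log s ≤ proj₁ s - 1#
        log-1+    : ∀ s (s≺1 : s ≺ 1#) → HasSum (logSeries s) (log (1# + s , 1+-positive {s} s≺1))

        logᴿ       : R⁺ → R.Carrier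
        log-const  : ∀ r → log (const⁺ r) ≈ const (logᴿ r)
        logᴿ-isMonoidIsomorphism :
          MonoidMorphisms.IsMonoidIsomorphism R⁺-rawMonoid R.+-rawMonoid logᴿ
        logᴿ-isOrderIsomorphism :
          IsOrderIsomorphism (R._≈_ on proj₁) R._≈_ (R._<_ on proj₁) R._<_ logᴿ

    infix 4 _≺≺_ _≼≼_

    _≺≺_ _≼≼_ : Rel 𝕋× κ
    s ≺≺ t = log ∣ s ∣⁺ ≺ log ∣ t ∣⁺
    s ≼≼ t = log ∣ s ∣⁺ ≼ log ∣ t ∣⁺

    module _ (∂ : Series → Series) (x : Monomial) where

      record IsFlatTransserialDerivation : Set (lsuc κ ⊔ lsuc σ) where
        field
          isStronglyLinear : IsStronglyLinear ∂
          leibniz          : ∀ s t → ∂ (s * t) ≈ ∂ s * t + s * ∂ t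
          -- ∂(log |s|) = ∂(s) / s, cleared of denominators
          ∂-log            : ∀ s → ∂ (log ∣ s ∣⁺) * proj₁ s ≈ ∂ (proj₁ s)
          surjective       : Surjective _≈_ _≈_ ∂
          x>0              : Positive (mono x)
          x≉1              : ¬ x 𝔑.≈ ε
          ∂x≈1             : ∂ (mono x) ≈ 1#
          flat             : ∀ {m n} → supp (∂ (mono m)) n →
                             ∃ λ f → ∃ λ w → mono× f ≺≺ mono× m × mono× w ≼≼ mono× x ×
                                             n 𝔑.≈ m ∙ f ∙ w

  record IsHField (∂ : Series → Series) : Set (κ ⊔ lsuc σ) where
    field
      ker⊆R : ∀ f → ∂ f ≈ 0# → ∃ λ r → f ≈ const r
      R⊆ker : ∀ r → ∂ (const r) ≈ 0#
      ∂-pos : ∀ (f : 𝕋>R) → 0# < ∂ (proj₁ f)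

  record IsStrongOrderedRingHomomorphism (φ : Series → Series) : Set (lsuc κ ⊔ lsuc σ) where
    field
      isRingHomomorphism  : RingMorphisms.IsRingHomomorphism rawRing rawRing φ
      isOrderHomomorphism : IsOrderHomomorphism _≈_ _≈_ _<_ _<_ φ
      isStronglyLinear    : IsStronglyLinear φ

    const-homo : ∀ r → φ (const r) ≈ const r
    const-homo r = begin
      φ (const r)   ≈⟨ IsStronglyLinear.cong isStronglyLinear r≈r•1 ⟩
      φ (r • 1#)    ≈⟨ LeftModuleMorphisms.IsLeftModuleHomomorphism.*ₗ-homo
                          (IsStronglyLinear.isLinear isStronglyLinear) r 1# ⟩
      r • φ 1#      ≈⟨ (λ m → R.*-congˡ (RingMorphisms.IsRingHomomorphism.1#-homo isRingHomomorphism m)) ⟩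
      r • 1#        ≈⟨ r≈r•1 ⟨
      const r       ∎
      where
      open SetoidReasoning seriesSetoid
      r≈r•1 : const r ≈ r • 1#
      r≈r•1 m = R.trans (const-cong (R.sym (R.*-identityʳ r)) m) (const-• r R.1# m)

    positive-homo : ∀ {f} → Positive f → Positive (φ f)
    positive-homo {f} f>0 = positive-resp {φ f - φ 0#} {φ f}
      (λ m → minus0 (φ f) (R.trans (RingMorphisms.IsRingHomomorphism.0#-homo isRingHomomorphism m) (0#-coeff m)))
      (IsOrderHomomorphism.mono isOrderHomomorphism {0#} {f}
        (positive-resp {f} {f - 0#} (λ m → R.sym (minus0 f (0#-coeff m))) f>0))
      where
      minus0 : ∀ s {m z} → z R.≈ R.0# → coeff s m R.+ R.- z R.≈ coeff s m
      minus0 s z≈0 = R.trans (R.+-congˡ (R.trans (R.-‿cong z≈0) R.-0#≈0#)) (R.+-identityʳ _)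

    >R-homo : ∀ {f} → (∀ r → const r < f) → ∀ r → const r < φ f
    >R-homo {f} f>R r = positive-resp {φ f - φ (const r)} {φ f - const r}
      (λ m → R.+-congˡ (R.-‿cong (const-homo r m)))
      (IsOrderHomomorphism.mono isOrderHomomorphism {const r} {f} (f>R r))

  record IsFlatTransserialComposition (log : 𝕋⁺ → Series) (_∘_ : Series → 𝕋>R → Series)
                                      (x : Monomial) : Set (lsuc κ ⊔ lsuc σ) where
    field
      ∘-congˡ        : ∀ f {s t : 𝕋>R} → proj₁ s ≈ proj₁ t → f ∘ s ≈ f ∘ t
      isHomomorphism : ∀ s → IsStrongOrderedRingHomomorphism (_∘ s)

    _⊚_ : 𝕋>R → 𝕋>R → 𝕋>R
    _⊚_ = λ f s → proj₁ f ∘ s ,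
      IsStrongOrderedRingHomomorphism.>R-homo (isHomomorphism s) {proj₁ f} (proj₂ f)

    field
      log-∘     : ∀ (f : 𝕋⁺) s →
                  log f ∘ s ≈ log (proj₁ f ∘ s ,
                    IsStrongOrderedRingHomomorphism.positive-homo (isHomomorphism s) {proj₁ f} (proj₂ f))
      assoc     : ∀ f s t → f ∘ (s ⊚ t) ≈ (f ∘ s) ∘ t
      -- f ∘ x is only meaningful if x lies in 𝕋>R.
      x>R       : ∀ r → const r < mono x
      identityˡ : ∀ s → mono x ∘ s ≈ proj₁ s
      identityʳ : ∀ f → f ∘ (mono x , x>R) ≈ f
      flat      : let _≺≺′_ = _≺≺_ log ; _≼≼′_ = _≼≼_ log in
                  ∀ s {m d n} → ¬ m 𝔑.≈ ε →
                  IsDominantMonomial (mono m ∘ s) d → supp (mono m ∘ s) n →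
                  ∃ λ f → ∃ λ w → ∃ λ u → supp (proj₁ s) u ×
                    (mono× f ≺≺′ mono× m) × (w ≼ᴺ ε) × (mono× w ≼≼′ mono× u) ×
                    (n 𝔑.≈ d ∙ f ∙ w)

  module _ {∂ : Series → Series} {_∘_ : Series → 𝕋>R → Series}
           (∂-strong : IsStronglyLinear ∂)
           (∘-hom : ∀ s → IsStrongOrderedRingHomomorphism (_∘ s)) where

    _⁽_⁾ : Series → ℕ → Series
    f ⁽ k ⁾ = fold f ∂ k

    private
      ⁽⁾-cong : ∀ k {f g} → f ≈ g → f ⁽ k ⁾ ≈ g ⁽ k ⁾
      ⁽⁾-cong zero    f≈g = f≈g
      ⁽⁾-cong (suc k) f≈g = IsStronglyLinear.cong ∂-strong (⁽⁾-cong k f≈g)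

      mono⁽⁾∘-cong : ∀ s k {m n} → m 𝔑.≈ n → (mono m ⁽ k ⁾) ∘ s ≈ (mono n ⁽ k ⁾) ∘ s
      mono⁽⁾∘-cong s k m≈n = IsStronglyLinear.cong
        (IsStrongOrderedRingHomomorphism.isStronglyLinear (∘-hom s)) (⁽⁾-cong k (mono-cong m≈n))

    suppSetoid : Series → Setoid κ κ
    suppSetoid f = On.setoid {B = ∃ (supp f)} 𝔑.setoid proj₁

    module _ (f : Series) (s : 𝕋>R) (δ : Series) where

      taylorTerms : Family (×-setoid (suppSetoid f) (≡.setoid ℕ))
      taylorTerms = record
        { to   = λ ((m , _) , k) → ((mono m ⁽ k ⁾) ∘ s) * δ ^ k
        ; cong = λ { {_ , k} (m≈n , ≡.refl) → *-cong (mono⁽⁾∘-cong s k m≈n) (λ _ → R.refl) }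
        }

      taylorSeries : Family (≡.setoid ℕ)
      taylorSeries = record
        { to   = λ k → (R.1/ (k !) {{k !≢0}} • ((f ⁽ k ⁾) ∘ s)) * δ ^ k
        ; cong = λ { ≡.refl m → R.refl }
        }

      taylorDoubleSeries : Family (×-setoid (suppSetoid f) (≡.setoid ℕ))
      taylorDoubleSeries = record
        { to   = λ ((m , _) , k) →
                   coeff f m • ((R.1/ (k !) {{k !≢0}} • ((mono m ⁽ k ⁾) ∘ s)) * δ ^ k)
        ; cong = λ { {_ , k} (m≈n , ≡.refl) o → R.*-cong (coeff-cong f m≈n)
                   (*-cong (λ p → R.*-congˡ (mono⁽⁾∘-cong s k m≈n p)) (λ _ → R.refl) o) }
        }

      record TaylorExpansion (δ≺s : δ ≺ proj₁ s) : Set (κ ⊔ lsuc σ) where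
        s+δ : 𝕋>R
        s+δ = proj₁ s + δ , >R-+ {proj₁ s} {δ} (proj₂ s) δ≺s
        field
          summable     : Summable taylorTerms
          hasSum       : HasSum taylorSeries (f ∘ s+δ)
          hasDoubleSum : HasSum taylorDoubleSeries (f ∘ s+δ)
          decreasing   : ∀ k → ¬ ((f ⁽ k ⁾) ∘ s) * δ ^ k ≈ 0# →
                         ((f ⁽ suc k ⁾) ∘ s) * δ ^ suc k ≺ ((f ⁽ k ⁾) ∘ s) * δ ^ k

  record TransserialStructure : Set (lsuc κ ⊔ lsuc σ) where
    infixl 9 _∘_ _⊚_
    field
      log : 𝕋⁺ → Series
      ∂   : Series → Series
      x   : Monomial
      _∘_ : Series → 𝕋>R → Series

      isTransserialField : IsExponentiallyClosedTransserialField log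
      isDerivation       : IsFlatTransserialDerivation log ∂ x
      isHField           : IsHField ∂
      isComposition      : IsFlatTransserialComposition log _∘_ x

    _⊚_ : 𝕋>R → 𝕋>R → 𝕋>R
    _⊚_ = IsFlatTransserialComposition._⊚_ isComposition

    x° : 𝕋>R
    x° = mono x , IsFlatTransserialComposition.x>R isComposition

    field
      chainRule : ∀ f s → ∂ (f ∘ s) ≈ ∂ (proj₁ s) * (∂ f ∘ s)
      taylor    : ∀ f s δ (δ≺s : δ ≺ proj₁ s) →
                  (∀ m → supp f m → (∂ (mono m) ∘ s) * δ ≺ mono m ∘ s) →
                  TaylorExpansion (IsFlatTransserialDerivation.isStronglyLinear isDerivation)
                                  (IsFlatTransserialComposition.isHomomorphism isComposition)
                                  f s δ δ≺s

      inv     : 𝕋>R → 𝕋>R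
      isGroup : IsGroup (_≈_ on proj₁) _⊚_ x° inv

      increasing : ∀ f → ¬ (∃ λ r → f ≈ const r) → 0# < ∂ f →
                   ∀ s t → proj₁ s < proj₁ t → f ∘ s < f ∘ t
      decreasing : ∀ f → ¬ (∃ λ r → f ≈ const r) → ∂ f < 0# →
                   ∀ s t → proj₁ s < proj₁ t → f ∘ t < f ∘ s

    infix 4 _≈°_ _<°_ _≤°_

    _≈°_ _<°_ _≤°_ : Rel 𝕋>R κ
    _≈°_ = _≈_ on proj₁
    _<°_ = _<_ on proj₁
    _≤°_ = _≤_ on proj₁

    Conjugate : Rel 𝕋>R (κ ⊔ lsuc σ)
    Conjugate f g = ∃ λ h → h ⊚ f ≈° g ⊚ h

    𝓒 : 𝕋>R → Pred 𝕋>R κ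
    𝓒 f h = h ⊚ f ≈° f ⊚ h

module Submission where

-- Since every f > x is conjugate to x + 1, it has an Abel function: some h > R
-- with h ∘ f = 1 + h. Composing with h turns the centralizer of f into
-- translations by constants: for each constant r, the solution u of
-- h ∘ u = r + h commutes with f. Everything else is the monotonicity of
-- left composition, applied to differences of such functions.
--
-- (1) Let h be an Abel function of g. If f exceeds 𝓒 g, it exceeds the
-- solutions u of h ∘ u = r + h, so D = h ∘ f - h exceeds every constant r. Then
-- D' > 0, so D < D ∘ g because x < g, and adding h ∘ g = 1 + h to both sides
-- gives h ∘ g ∘ f < h ∘ f ∘ g.
--
-- (2) Let h and m be Abel functions of f and g, where g ≤ f, and let g₀ commute
-- with g; as x commutes with f, only x < g₀ matters. The difference
-- m ∘ g₀ - m is invariant under g, hence a constant r. The difference P = h - m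
-- satisfies P ∘ g ≤ P, so it is not increasing, whence P ∘ g₀ ≤ P, that is,
-- h ∘ g₀ ≤ r + h. So the solution f₀ of h ∘ f₀ = r + h, which commutes with f,
-- satisfies g₀ ≤ f₀.

open import Defs
open import Algebra.Bundles using (AbelianGroup; Group)
open import Algebra.Morphism.Structures using (module RingMorphisms)
open import Axiom.ExcludedMiddle using (ExcludedMiddle)
open import Data.Empty using (⊥-elim)
open import Data.Product.Base using (∃; _×_; _,_; proj₁; proj₂)
open import Data.Sum.Base using (_⊎_; inj₁; inj₂)
open import Level using (Level)
open import Relation.Binary.Bundles using (Setoid; StrictTotalOrder)
open import Relation.Binary.Definitions using (Trichotomous; tri<; tri≈; tri>)
open import Relation.Binary.Morphism.Structures using (IsOrderHomomorphism)
open import Relation.Nullary using (¬_; yes; no)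
open import Relation.Unary using (_∈_)
import Algebra.Properties.AbelianGroup as AbelianGroupProperties
import Algebra.Properties.CommutativeSemigroup as CommutativeSemigroupProperties
import Algebra.Properties.Group as GroupProperties
import Relation.Binary.Reasoning.Setoid as SetoidReasoning
import Relation.Binary.Reasoning.StrictPartialOrder as OrderReasoning

-- The ordered additive group of well-based series

module OrderedAdditiveGroup
  (em : {ℓ : Level} → ExcludedMiddle ℓ) {κ : Level} (σ : Level)
  (R : OrderedField κ) (𝔑 : LinearlyOrderedAbelianGroup κ) where

  open WellBased em σ R 𝔑

  +-abelianGroup : AbelianGroup _ _
  +-abelianGroup = record
    { Carrier = Series ; _≈_ = _≈_ ; _∙_ = _+_ ; ε = 0# ; _⁻¹ = -_
    ; isAbelianGroup = record
      { isGroup = record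
        { isMonoid = record
          { isSemigroup = record
            { isMagma = record
              { isEquivalence = Setoid.isEquivalence seriesSetoid
              ; ∙-cong        = λ s≈t u≈v m → R.+-cong (s≈t m) (u≈v m)
              }
            ; assoc = λ s t u m → R.+-assoc _ _ _
            }
          ; identity = (λ s m → R.trans (R.+-congʳ (0#-coeff m)) (R.+-identityˡ _))
                     , (λ s m → R.trans (R.+-congˡ (0#-coeff m)) (R.+-identityʳ _))
          }
        ; inverse = (λ s m → R.trans (R.-‿inverseˡ _) (R.sym (0#-coeff m)))
                  , (λ s m → R.trans (R.-‿inverseʳ _) (R.sym (0#-coeff m)))
        ; ⁻¹-cong = λ s≈t m → R.-‿cong (s≈t m)
        }
      ; comm = λ s t m → R.+-comm _ _
      }
    }

  module Add = AbelianGroup +-abelianGroup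
  module AddProperties = AbelianGroupProperties +-abelianGroup
  open CommutativeSemigroupProperties Add.commutativeSemigroup public
    using (interchange; x∙yz≈y∙xz)

  <-irrefl : ∀ s t → s ≈ t → ¬ s < t
  <-irrefl s t s≈t =
    ¬0-positive {t - s} (AddProperties.x≈y⇒x∙y⁻¹≈ε {t} {s} (Add.sym {s} {t} s≈t))

  <-trans : ∀ s t u → s < t → t < u → s < u
  <-trans s t u s<t t<u = positive-resp {(u - t) + (t - s)} {u - s}
    (begin
      (u - t) + (t - s)  ≈⟨ Add.assoc (u - t) t (- s) ⟨
      (u - t) + t - s    ≈⟨ Add.∙-congʳ { - s} {(u - t) + t} {u} (AddProperties.//-rightDividesˡ t u) ⟩
      u - s              ∎)
    (positive-+ {u - t} {t - s} t<u s<t)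
    where open SetoidReasoning seriesSetoid

  <-respʳ-≈ : ∀ s t u → t ≈ u → s < t → s < u
  <-respʳ-≈ s t u t≈u = positive-resp {t - s} {u - s} (Add.∙-congʳ { - s} {t} {u} t≈u)

  <-respˡ-≈ : ∀ s t u → t ≈ u → t < s → u < s
  <-respˡ-≈ s t u t≈u = positive-resp {s - t} {s - u}
    (Add.∙-congˡ {s} { - t} { - u} (Add.⁻¹-cong {t} {u} t≈u))

  <-cmp : Trichotomous _≈_ _<_
  <-cmp s t with em {P = s ≈ t}
  ... | yes s≈t = tri≈ (<-irrefl s t s≈t) s≈t (<-irrefl t s (Add.sym {s} {t} s≈t))
  ... | no  s≉t with ≉0⇒pos⊎neg {t - s} (λ t-s≈0 →
                       s≉t (Add.sym {t} {s} (AddProperties.x∙y⁻¹≈ε⇒x≈y t s t-s≈0)))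
  ...   | inj₁ s<t = tri< s<t s≉t λ t<s → <-irrefl s s (Add.refl {s}) (<-trans s t s s<t t<s)
  ...   | inj₂ neg = tri> (λ s<t → <-irrefl s s (Add.refl {s}) (<-trans s t s s<t t<s)) s≉t t<s
    where
    t<s : t < s
    t<s = positive-resp { - (t - s)} {s - t} (AddProperties.⁻¹-anti-homo‿- t s) neg

  <-strictTotalOrder : StrictTotalOrder _ _ _
  <-strictTotalOrder = record
    { Carrier = Series ; _≈_ = _≈_ ; _<_ = _<_
    ; isStrictTotalOrder = record
      { isStrictPartialOrder = record
        { isEquivalence = Add.isEquivalence
        ; irrefl        = λ {s} {t} → <-irrefl s t
        ; trans         = λ {s} {t} {u} → <-trans s t u
        ; <-resp-≈      = (λ {s} {t} {u} → <-respʳ-≈ s t u) , (λ {s} {t} {u} → <-respˡ-≈ s t u)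
        }
      ; compare = <-cmp
      }
    }

  module Reasoning = OrderReasoning (StrictTotalOrder.strictPartialOrder <-strictTotalOrder)

  +-monoˡ-< : ∀ u {s} {t} → s < t → s + u < t + u
  +-monoˡ-< u {s} {t} = positive-resp {t - s} {(t + u) - (s + u)} (begin
    t - s                ≈⟨ Add.identityʳ (t - s) ⟨
    (t - s) + 0#         ≈⟨ Add.∙-congˡ {t - s} {u - u} {0#} (Add.inverseʳ u) ⟨
    (t - s) + (u - u)    ≈⟨ interchange t (- s) u (- u) ⟩
    (t + u) + (- s - u)  ≈⟨ Add.∙-congˡ {t + u} { - s - u} { - (s + u)} (AddProperties.⁻¹-∙-comm s u) ⟩
    (t + u) - (s + u)    ∎)
    where open SetoidReasoning seriesSetoid

  +-monoˡ-≤ : ∀ u {s} {t} → s ≤ t → s + u ≤ t + u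
  +-monoˡ-≤ u {s} {t} (inj₁ s<t) = inj₁ (+-monoˡ-< u {s} {t} s<t)
  +-monoˡ-≤ u {s} {t} (inj₂ s≈t) = inj₂ (Add.∙-congʳ {u} {s} {t} s≈t)

  +-cancelʳ-≤ : ∀ u s t → s + u ≤ t + u → s ≤ t
  +-cancelʳ-≤ u s t s+u≤t+u = begin
    s          ≈⟨ AddProperties.//-rightDividesʳ u s ⟨
    s + u - u  ≤⟨ +-monoˡ-≤ (- u) {s + u} {t + u} s+u≤t+u ⟩
    t + u - u  ≈⟨ AddProperties.//-rightDividesʳ u t ⟩
    t          ∎
    where open Reasoning

  const-+ : ∀ q r → const (q R.+ r) ≈ const q + const r
  const-+ q r m with em {P = m 𝔑.≈ ε}
  ... | yes m≈ε = R.trans (single-≈ _ m≈ε)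
                    (R.sym (R.+-cong (single-≈ q m≈ε) (single-≈ r m≈ε)))
  ... | no  m≉ε = R.trans (single-≉ _ m≉ε)
                    (R.sym (R.trans (R.+-cong (single-≉ q m≉ε) (single-≉ r m≉ε)) (R.+-identityˡ _)))

  -- The translate r + h of an element h of 𝕋>R.
  translate : R.Carrier → 𝕋>R → 𝕋>R
  translate r (h , h>R) = const r + h , λ q → let q-r = q R.+ R.- r in begin-strict
    const q              ≈⟨ const-cong (R.trans (R.+-assoc q (R.- r) r)
                              (R.trans (R.+-congˡ (R.-‿inverseˡ r)) (R.+-identityʳ q))) ⟨
    const (q-r R.+ r)    ≈⟨ const-+ q-r r ⟩
    const q-r + const r  <⟨ +-monoˡ-< (const r) {const q-r} {h} (h>R q-r) ⟩
    h + const r          ≈⟨ Add.comm h (const r) ⟩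
    const r + h          ∎
    where open Reasoning

-- Monotonicity of composition, Abel functions and centralizers

module Centralizers
  (em : {ℓ : Level} → ExcludedMiddle ℓ) {κ : Level} (σ : Level)
  (R : OrderedField κ) (𝔑 : LinearlyOrderedAbelianGroup κ)
  (T : WellBased.TransserialStructure em σ R 𝔑) where

  open WellBased em σ R 𝔑
  open TransserialStructure T
  open OrderedAdditiveGroup em σ R 𝔑
  open Reasoning

  ∘-group : Group _ _
  ∘-group = record
    { Carrier = 𝕋>R ; _≈_ = _≈°_ ; _∙_ = _⊚_ ; ε = x° ; _⁻¹ = inv ; isGroup = isGroup }

  module ∘-Properties = GroupProperties ∘-group

  private
    module Composition = IsFlatTransserialComposition isComposition
    module Homomorphism (s : 𝕋>R) =
      IsStrongOrderedRingHomomorphism (Composition.isHomomorphism s)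

  open Composition using () renaming (∘-congˡ to ∘-congʳ; assoc to ∘-assoc; identityʳ to ∘-identityʳ)
  open Homomorphism using () renaming (const-homo to const-∘)

  ∘-congˡ : ∀ s f g → f ≈ g → f ∘ s ≈ g ∘ s
  ∘-congˡ s f g = IsOrderHomomorphism.cong (Homomorphism.isOrderHomomorphism s) {f} {g}

  ∘-distribʳ-+ : ∀ s f g → (f + g) ∘ s ≈ f ∘ s + g ∘ s
  ∘-distribʳ-+ s = RingMorphisms.IsRingHomomorphism.+-homo (Homomorphism.isRingHomomorphism s)

  const+-∘ : ∀ r f s → (const r + f) ∘ s ≈ const r + f ∘ s
  const+-∘ r f s = begin-equality
    (const r + f) ∘ s      ≈⟨ ∘-distribʳ-+ s (const r) f ⟩
    const r ∘ s + f ∘ s    ≈⟨ Add.∙-congʳ {f ∘ s} {const r ∘ s} {const r} (const-∘ s r) ⟩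
    const r + f ∘ s        ∎

  IsConstant : Series → Set κ
  IsConstant f = ∃ λ r → f ≈ const r

  >R⇒nonconstant : ∀ (f : 𝕋>R) → ¬ IsConstant (proj₁ f)
  >R⇒nonconstant (f , f>R) (r , f≈r) = <-irrefl (const r) f (Add.sym {f} {const r} f≈r) (f>R r)

  ∘-monoʳ-< : ∀ (f : 𝕋>R) s t → s <° t → proj₁ f ∘ s < proj₁ f ∘ t
  ∘-monoʳ-< f = increasing (proj₁ f) (>R⇒nonconstant f) (IsHField.∂-pos isHField f)

  ∘-monoʳ-≤ : ∀ (f : 𝕋>R) s t → s ≤° t → proj₁ f ∘ s ≤ proj₁ f ∘ t
  ∘-monoʳ-≤ f s t (inj₁ s<t) = inj₁ (∘-monoʳ-< f s t s<t)
  ∘-monoʳ-≤ f s t (inj₂ s≈t) = inj₂ (∘-congʳ (proj₁ f) {s} {t} s≈t)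

  inv-∘ : ∀ h s → proj₁ (inv h) ∘ (h ⊚ s) ≈ proj₁ s
  inv-∘ = ∘-Properties.\\-leftDividesʳ

  ∘-inv : ∀ h s → proj₁ h ∘ (inv h ⊚ s) ≈ proj₁ s
  ∘-inv = ∘-Properties.\\-leftDividesˡ

  ∘-cancelˡ-< : ∀ (h : 𝕋>R) s t → proj₁ h ∘ s < proj₁ h ∘ t → s <° t
  ∘-cancelˡ-< h s t hs<ht = begin-strict
    proj₁ s                     ≈⟨ inv-∘ h s ⟨
    proj₁ (inv h) ∘ (h ⊚ s)     <⟨ ∘-monoʳ-< (inv h) (h ⊚ s) (h ⊚ t) hs<ht ⟩
    proj₁ (inv h) ∘ (h ⊚ t)     ≈⟨ inv-∘ h t ⟩
    proj₁ t                     ∎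

  ∘-cancelˡ-≤ : ∀ (h : 𝕋>R) s t → proj₁ h ∘ s ≤ proj₁ h ∘ t → s ≤° t
  ∘-cancelˡ-≤ h s t hs≤ht = begin
    proj₁ s                     ≈⟨ inv-∘ h s ⟨
    proj₁ (inv h) ∘ (h ⊚ s)     ≤⟨ ∘-monoʳ-≤ (inv h) (h ⊚ s) (h ⊚ t) hs≤ht ⟩
    proj₁ (inv h) ∘ (h ⊚ t)     ≈⟨ inv-∘ h t ⟩
    proj₁ t                     ∎

  -- As ker ∂ consists of the constants, a nonconstant P has P' > 0 or P' < 0, so
  -- it is strictly increasing or strictly decreasing; P itself is P ∘ x.
  <∘⊎>∘ : ∀ P → ¬ IsConstant P →
          (∀ g → x° <° g → P < P ∘ g) ⊎ (∀ g → x° <° g → P ∘ g < P)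
  <∘⊎>∘ P ¬const with <-cmp 0# (∂ P)
  ... | tri< ∂P>0 _ _ = inj₁ λ g x<g → begin-strict
          P       ≈⟨ ∘-identityʳ P ⟨
          P ∘ x°  <⟨ increasing P ¬const ∂P>0 x° g x<g ⟩
          P ∘ g   ∎
  ... | tri≈ _ 0≈∂P _ = ⊥-elim (¬const (IsHField.ker⊆R isHField P (Add.sym {0#} {∂ P} 0≈∂P)))
  ... | tri> _ _ ∂P<0 = inj₂ λ g x<g → begin-strict
          P ∘ g   <⟨ decreasing P ¬const ∂P<0 x° g x<g ⟩
          P ∘ x°  ≈⟨ ∘-identityʳ P ⟩
          P       ∎

  invariant⇒constant : ∀ P g → x° <° g → P ∘ g ≈ P → IsConstant P
  invariant⇒constant P g x<g Pg≈P with em {P = IsConstant P}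
  ... | yes const = const
  ... | no ¬const with <∘⊎>∘ P ¬const
  ...   | inj₁ up   = ⊥-elim (<-irrefl P (P ∘ g) (Add.sym {P ∘ g} {P} Pg≈P) (up g x<g))
  ...   | inj₂ down = ⊥-elim (<-irrefl (P ∘ g) P Pg≈P (down g x<g))

  -- A single g > x with P ∘ g ≤ P shows that P is constant or decreasing.
  ∘≤⇒∘≤ : ∀ P g u → x° <° g → x° <° u → P ∘ g ≤ P → P ∘ u ≤ P
  ∘≤⇒∘≤ P g u x<g x<u Pg≤P with em {P = IsConstant P}
  ... | yes (r , P≈r) = begin
          P ∘ u        ≈⟨ ∘-congˡ u P (const r) P≈r ⟩
          const r ∘ u  ≈⟨ const-∘ u r ⟩
          const r      ≈⟨ P≈r ⟨
          P            ∎
  ... | no ¬const with <∘⊎>∘ P ¬const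
  ...   | inj₂ down = inj₁ (down u x<u)
  ...   | inj₁ up   = ⊥-elim (<-irrefl P P (Add.refl {P}) (begin-strict
          P      <⟨ up g x<g ⟩
          P ∘ g  ≤⟨ Pg≤P ⟩
          P      ∎))

  -- An Abel function of g conjugates g to the translation x + 1.
  IsAbelFunction : 𝕋>R → 𝕋>R → Set κ
  IsAbelFunction g h = proj₁ h ∘ g ≈ 1# + proj₁ h

  x<translate1 : x° <° translate R.1# x°
  x<translate1 = begin-strict
    mono x       ≈⟨ Add.identityˡ (mono x) ⟨
    0# + mono x  <⟨ +-monoˡ-< (mono x) {0#} {1#} 0<1 ⟩
    1# + mono x  ∎
    where
    0<1 : 0# < 1#
    0<1 = positive-resp {1#} {1# - 0#} (λ m → R.sym (R.trans
      (R.+-congˡ (R.trans (R.-‿cong (0#-coeff m)) R.-0#≈0#)) (R.+-identityʳ _)))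
      (const-positive R.0<1)

  abelFunction : (∀ f g → x° <° f → x° <° g → Conjugate f g) →
                 ∀ g → x° <° g → ∃ (IsAbelFunction g)
  abelFunction conjugate g x<g
    with h , hg≈ ← conjugate g (translate R.1# x°) x<g x<translate1 = h , (begin-equality
    proj₁ h ∘ g        ≈⟨ hg≈ ⟩
    (1# + mono x) ∘ h  ≈⟨ const+-∘ R.1# (mono x) h ⟩
    1# + mono x ∘ h    ≈⟨ Add.∙-congˡ {1#} {mono x ∘ h} {proj₁ h} (Composition.identityˡ h) ⟩
    1# + proj₁ h       ∎)

  -- The conjugate of the translation x + r by h, that is, the solution u of
  -- h ∘ u = r + h.
  conjugatedTranslation : 𝕋>R → R.Carrier → 𝕋>R
  conjugatedTranslation h r = inv h ⊚ translate r h

  ∘-conjugatedTranslation : ∀ h r → proj₁ h ∘ conjugatedTranslation h r ≈ const r + proj₁ h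
  ∘-conjugatedTranslation h r = ∘-inv h (translate r h)

  conjugatedTranslation∈𝓒 : ∀ g h → IsAbelFunction g h → ∀ r → conjugatedTranslation h r ∈ 𝓒 g
  conjugatedTranslation∈𝓒 g h hg≈ r = ∘-Properties.∙-cancelˡ h (u ⊚ g) (g ⊚ u) (begin-equality
    proj₁ h ∘ (u ⊚ g)         ≈⟨ ∘-assoc (proj₁ h) u g ⟩
    proj₁ h ∘ u ∘ g           ≈⟨ ∘-congˡ g (proj₁ h ∘ u) (const r + proj₁ h) hu≈ ⟩
    (const r + proj₁ h) ∘ g   ≈⟨ const+-∘ r (proj₁ h) g ⟩
    const r + proj₁ h ∘ g     ≈⟨ Add.∙-congˡ {const r} {proj₁ h ∘ g} {1# + proj₁ h} hg≈ ⟩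
    const r + (1# + proj₁ h)  ≈⟨ x∙yz≈y∙xz (const r) 1# (proj₁ h) ⟩
    1# + (const r + proj₁ h)  ≈⟨ Add.∙-congˡ {1#} {proj₁ h ∘ u} {const r + proj₁ h} hu≈ ⟨
    1# + proj₁ h ∘ u          ≈⟨ const+-∘ R.1# (proj₁ h) u ⟨
    (1# + proj₁ h) ∘ u        ≈⟨ ∘-congˡ u (proj₁ h ∘ g) (1# + proj₁ h) hg≈ ⟨
    proj₁ h ∘ g ∘ u           ≈⟨ ∘-assoc (proj₁ h) g u ⟨
    proj₁ h ∘ (g ⊚ u)         ∎)
    where
    u = conjugatedTranslation h r
    hu≈ = ∘-conjugatedTranslation h r

  -- For P = s - t, composition satisfies P ∘ u + t ∘ u = s ∘ u.
  difference-∘ : ∀ s t u → (s - t) ∘ u + t ∘ u ≈ s ∘ u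
  difference-∘ s t u = begin-equality
    (s - t) ∘ u + t ∘ u  ≈⟨ ∘-distribʳ-+ u (s - t) t ⟨
    (s - t + t) ∘ u      ≈⟨ ∘-congˡ u (s - t + t) s (AddProperties.//-rightDividesˡ t s) ⟩
    s ∘ u                ∎

  -- If h is an Abel function of g, then P + h ∘ g = 1 + (P + h); with
  -- P = s - h this is 1 + s.
  difference+abel : ∀ g h s → IsAbelFunction g h → (s - proj₁ h) + proj₁ h ∘ g ≈ 1# + s
  difference+abel g (h , _) s hg≈ = begin-equality
    (s - h) + h ∘ g     ≈⟨ Add.∙-congˡ {s - h} {h ∘ g} {1# + h} hg≈ ⟩
    (s - h) + (1# + h)  ≈⟨ x∙yz≈y∙xz (s - h) 1# h ⟩
    1# + (s - h + h)    ≈⟨ Add.∙-congˡ {1#} {s - h + h} {s} (AddProperties.//-rightDividesˡ h s) ⟩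
    1# + s              ∎

  above-𝓒⇒commutator> : ∀ f g h → x° <° g → IsAbelFunction g h →
                        (∀ u → u ∈ 𝓒 g → u <° f) → g ⊚ f <° f ⊚ g
  above-𝓒⇒commutator> f g h x<g hg≈ f>𝓒 =
    ∘-cancelˡ-< h (g ⊚ f) (f ⊚ g) (begin-strict
      proj₁ h ∘ (g ⊚ f)     ≈⟨ ∘-assoc (proj₁ h) g f ⟩
      proj₁ h ∘ g ∘ f       ≈⟨ ∘-congˡ f (proj₁ h ∘ g) (1# + proj₁ h) hg≈ ⟩
      (1# + proj₁ h) ∘ f    ≈⟨ const+-∘ R.1# (proj₁ h) f ⟩
      1# + proj₁ h ∘ f      ≈⟨ difference+abel g h (proj₁ h ∘ f) hg≈ ⟨
      D + proj₁ h ∘ g       <⟨ +-monoˡ-< (proj₁ h ∘ g) {D} {D ∘ g} D<D∘g ⟩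
      D ∘ g + proj₁ h ∘ g   ≈⟨ difference-∘ (proj₁ h ∘ f) (proj₁ h) g ⟩
      proj₁ h ∘ f ∘ g       ≈⟨ ∘-assoc (proj₁ h) f g ⟨
      proj₁ h ∘ (f ⊚ g)     ∎)
    where
    D : Series
    D = proj₁ h ∘ f - proj₁ h

    D>R : ∀ r → const r < D
    D>R r = begin-strict
      const r                    ≈⟨ AddProperties.//-rightDividesʳ (proj₁ h) (const r) ⟨
      const r + proj₁ h - proj₁ h
        <⟨ +-monoˡ-< (- proj₁ h) {const r + proj₁ h} {proj₁ h ∘ f} (begin-strict
             const r + proj₁ h  ≈⟨ ∘-conjugatedTranslation h r ⟨
             proj₁ h ∘ u        <⟨ ∘-monoʳ-< h u f (f>𝓒 u (conjugatedTranslation∈𝓒 g h hg≈ r)) ⟩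
             proj₁ h ∘ f        ∎) ⟩
      D                          ∎
      where u = conjugatedTranslation h r

    D<D∘g : D < D ∘ g
    D<D∘g = begin-strict
      D       ≈⟨ ∘-identityʳ D ⟨
      D ∘ x°  <⟨ ∘-monoʳ-< (D , D>R) x° g x<g ⟩
      D ∘ g   ∎

  ∈𝓒⇒translation : ∀ g m → x° <° g → IsAbelFunction g m →
                   ∀ u → u ∈ 𝓒 g → ∃ λ r → proj₁ m ∘ u ≈ const r + proj₁ m
  ∈𝓒⇒translation g m x<g mg≈ u ug≈gu =
    let r , D≈r = invariant⇒constant D g x<g D∘g≈D in r , (begin-equality
      proj₁ m ∘ u        ≈⟨ AddProperties.//-rightDividesˡ (proj₁ m) (proj₁ m ∘ u) ⟨
      D + proj₁ m        ≈⟨ Add.∙-congʳ {proj₁ m} {D} {const r} D≈r ⟩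
      const r + proj₁ m  ∎)
    where
    D : Series
    D = proj₁ m ∘ u - proj₁ m

    D∘g≈D : D ∘ g ≈ D
    D∘g≈D = AddProperties.∙-cancelʳ (proj₁ m ∘ g) (D ∘ g) D (begin-equality
      D ∘ g + proj₁ m ∘ g  ≈⟨ difference-∘ (proj₁ m ∘ u) (proj₁ m) g ⟩
      proj₁ m ∘ u ∘ g      ≈⟨ ∘-assoc (proj₁ m) u g ⟨
      proj₁ m ∘ (u ⊚ g)    ≈⟨ ∘-congʳ (proj₁ m) {u ⊚ g} {g ⊚ u} ug≈gu ⟩
      proj₁ m ∘ (g ⊚ u)    ≈⟨ ∘-assoc (proj₁ m) g u ⟩
      proj₁ m ∘ g ∘ u      ≈⟨ ∘-congˡ u (proj₁ m ∘ g) (1# + proj₁ m) mg≈ ⟩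
      (1# + proj₁ m) ∘ u   ≈⟨ const+-∘ R.1# (proj₁ m) u ⟩
      1# + proj₁ m ∘ u     ≈⟨ difference+abel g m (proj₁ m ∘ u) mg≈ ⟨
      D + proj₁ m ∘ g      ∎)

  x°∈𝓒 : ∀ f → x° ∈ 𝓒 f
  x°∈𝓒 f = Group.trans ∘-group {x° ⊚ f} {f} {f ⊚ x°} (Group.identityˡ ∘-group f)
    (Group.sym ∘-group {f ⊚ x°} {f} (Group.identityʳ ∘-group f))

  𝓒-cofinal : ∀ f g h m → x° <° g → IsAbelFunction f h → IsAbelFunction g m →
              g ≤° f → ∀ u → u ∈ 𝓒 g → ∃ λ v → v ∈ 𝓒 f × u ≤° v
  𝓒-cofinal f g h m x<g hf≈ mg≈ g≤f u u∈𝓒g with <-cmp (mono x) (proj₁ u)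
  ... | tri≈ _ x≈u _ = x° , x°∈𝓒 f , inj₂ (Add.sym {mono x} {proj₁ u} x≈u)
  ... | tri> _ _ u<x = x° , x°∈𝓒 f , inj₁ u<x
  ... | tri< x<u _ _ with r , mu≈ ← ∈𝓒⇒translation g m x<g mg≈ u u∈𝓒g =
    v , conjugatedTranslation∈𝓒 f h hf≈ r , ∘-cancelˡ-≤ h u v (begin
      proj₁ h ∘ u              ≈⟨ difference-∘ (proj₁ h) (proj₁ m) u ⟨
      P ∘ u + proj₁ m ∘ u      ≤⟨ +-monoˡ-≤ (proj₁ m ∘ u) {P ∘ u} {P}
                                    (∘≤⇒∘≤ P g u x<g x<u P∘g≤P) ⟩
      P + proj₁ m ∘ u          ≈⟨ Add.∙-congˡ {P} {proj₁ m ∘ u} {const r + proj₁ m} mu≈ ⟩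
      P + (const r + proj₁ m)  ≈⟨ x∙yz≈y∙xz P (const r) (proj₁ m) ⟩
      const r + (P + proj₁ m)  ≈⟨ Add.∙-congˡ {const r} {P + proj₁ m} {proj₁ h}
                                    (AddProperties.//-rightDividesˡ (proj₁ m) (proj₁ h)) ⟩
      const r + proj₁ h        ≈⟨ ∘-conjugatedTranslation h r ⟨
      proj₁ h ∘ v              ∎)
    where
    v = conjugatedTranslation h r

    P : Series
    P = proj₁ h - proj₁ m

    P∘g≤P : P ∘ g ≤ P
    P∘g≤P = +-cancelʳ-≤ (proj₁ m ∘ g) (P ∘ g) P (begin
      P ∘ g + proj₁ m ∘ g  ≈⟨ difference-∘ (proj₁ h) (proj₁ m) g ⟩
      proj₁ h ∘ g          ≤⟨ ∘-monoʳ-≤ h g f g≤f ⟩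
      proj₁ h ∘ f          ≈⟨ hf≈ ⟩
      1# + proj₁ h         ≈⟨ difference+abel g m (proj₁ h) mg≈ ⟨
      P + proj₁ m ∘ g      ∎)

proposition5 :
  (em : {ℓ : Level} → ExcludedMiddle ℓ) {κ : Level} (σ : Level)
  (R : OrderedField κ) (𝔑 : LinearlyOrderedAbelianGroup κ)
  (T : WellBased.TransserialStructure em σ R 𝔑) →
  let open WellBased em σ R 𝔑
      open TransserialStructure T
  in
  (∀ f g → x° <° f → x° <° g → Conjugate f g) →
  ∀ f g → x° <° f → x° <° g →
    ((∀ h → h ∈ 𝓒 g → h <° f) → g ⊚ f <° f ⊚ g) ×
    (g ≤° f → ∀ g₀ → g₀ ∈ 𝓒 g → ∃ λ f₀ → f₀ ∈ 𝓒 f × g₀ ≤° f₀)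
proposition5 em σ R 𝔑 T conjugate f g x<f x<g =
  let h , hf≈ = abelFunction conjugate f x<f
      m , mg≈ = abelFunction conjugate g x<g
  in above-𝓒⇒commutator> f g m x<g mg≈ , 𝓒-cofinal f g h m x<g hf≈ mg≈
  where open Centralizers em σ R 𝔑 T
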